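{- Let $p$ be an odd prime and let $c$ be an integer. Suppose $c\not\equiv\pm2\pmod{p}$. Let $D_p(c)=\left[(i^2+cij+j^2)^{p-2}\right]_{1\le i,j\le p-1}$. Then the following results hold. (1) Suppose $\left(\frac{c^2-4}{p}\right)=1$. Then $p\mid\det D_p(c)$ if and only if $$cu_k(-c,1)+\left[k(4-c^2)+6-c^2\right]u_{k+1}(-c,1)\equiv0\pmod{p}$$ for some $0\le k\le p-3$. (2) Suppose $\left(\frac{c^2-4}{p}\right)=-1$. Then $p\mid\det D_p(c)$ if and only if $$-cu_k(-c,1)+(2-c^2)u_{k+1}(-c,1)\equiv0\pmod{p}$$ for some $0\le k\le p-3$.
   Context: $\left(\frac{\cdot}{p}\right)$ denotes the Legendre symbol modulo $p$, and $k$ ranges over integers. $D_p(c)$ is the $(p-1)\times(p-1)$ integer matrix whose $(i,j)$ entry is $(i^2+cij+j^2)^{p-2}$, $1\le i,j\le p-1$. For $A,B\in\mathbb{Z}$, the Lucas sequence $u_n(A,B)$ $(n=0,1,2,\ldots)$ is defined by $u_0(A,B)=0$, $u_1(A,B)=1$ and $u_{n+1}(A,B)=Au_n(A,B)-Bu_{n-1}(A,B)$ for $n\ge1$.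
   Formalization: Part (2) is stated and proved for p ≠ 3 only: for p = 3 it is false (c = 0 gives det D_3(0) = −9, divisible by 3, while the only k is 0, where the expression equals 2); every case with p = 3 in part (2) fails in this way. -}

module Defs where

open import Algebra.Properties.CommutativeMonoid.Sum as Sum using ()
open import Data.Fin.Base using (Fin; zero; suc; toℕ; punchIn)
open import Data.Fin.Properties using (any?)
open import Data.Integer.Base
  using (ℤ; +_; -_; _+_; _-_; _*_; _^_; 0ℤ; 1ℤ; -1ℤ)
open import Data.Integer.Divisibility.Signed using (_∣_; _∣?_)
open import Data.Integer.Properties using (+-0-commutativeMonoid)
open import Data.Nat.Base using (ℕ; zero; suc; _∸_)
open import Relation.Nullary.Decidable.Core using (yes; no)

open Sum +-0-commutativeMonoid using (sum)

infix 4 _≡_[mod_]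

_≡_[mod_] : ℤ → ℤ → ℕ → Set
a ≡ b [mod p ] = + p ∣ a - b

-- The search for a square root of a modulo p only visits the residues
-- 0, …, p - 1, which represent all classes.
legendre : ℤ → ℕ → ℤ
legendre a p with + p ∣? a
... | yes _ = 0ℤ
... | no  _ with any? {n = p} (λ x → + p ∣? (+ toℕ x) ^ 2 - a)
...   | yes _ = 1ℤ
...   | no  _ = -1ℤ

lucas : ℤ → ℤ → ℕ → ℤ
lucas A B zero          = 0ℤ
lucas A B (suc zero)    = 1ℤ
lucas A B (suc (suc n)) = A * lucas A B (suc n) - B * lucas A B n

Matrix : ℕ → Set
Matrix n = Fin n → Fin n → ℤ

-- Laplace expansion along the first row.
det : ∀ n → Matrix n → ℤ
det zero    M = 1ℤ
det (suc n) M =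
  sum λ j → -1ℤ ^ toℕ j * M zero j * det n (λ i k → M (suc i) (punchIn j k))

-- The index r : Fin (p ∸ 1) stands for the row or column number
-- 1 + toℕ r, so that the numbers run from 1 to p - 1.  The truncated
-- subtractions are exact for p ≥ 2.
D : (p : ℕ) → ℤ → Matrix (p ∸ 1)
D p c r s = (i ^ 2 + c * i * j + j ^ 2) ^ (p ∸ 2)
  where
  i = + suc (toℕ r)
  j = + suc (toℕ s)

{-# OPTIONS --safe #-}
module Submission where

-- Put A = - c, μ = 4 - c² and Q t = t² + c t + 1.  If g t = Σ_{k ≤ p-2} w k t^k
-- equals μ (Q t)^(p-2) at every t ≢ 0 mod p, then with t = i / j
-- the matrix μ D_p(c) is [i^k] diag (w k) [j^-k] diag (j^(2(p-2))), and the outer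
-- factors are invertible because [i^k] [j^-k] = - I.  So p ∣ det D_p(c) iff some
-- w k vanishes, and it remains to check that the expressions of the theorem are
-- such coefficients.  Multiplying by Q telescopes any sequence obeying the Lucas
-- recurrence, which reduces Q g = μ to the values u_{p-1} and u_p.
--
-- If c² - 4 is a nonresidue, Q has no zero mod p.  Frobenius in ℤ[α], α² = A α - 1,
-- gives u_p = ± 1, and u_p = 1 would make Σ u_{k+1} t^k vanish at all t ≢ 0.  So
-- u_p = -1 and u_{p-1} = - A.  If c² - 4 is a residue, then u_{p-1} = 0, u_p = 1;
-- here Q g = μ only holds off the zeros of Q, and at a zero g is summed explicitly.

open import Algebra.Bundles using (CommutativeSemiring)
open import Algebra.Properties.CommutativeMonoid.Mult as Mult using ()
open import Algebra.Properties.CommutativeMonoid.Sum as Monoid-Sum using ()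
open import Algebra.Properties.CommutativeSemiring.Binomial as Binomial using ()
open import Algebra.Properties.Semiring.Exp as Exp using ()
open import Algebra.Properties.Semiring.Sum as Semiring-Sum using ()
open import Algebra.Structures.Biased using (isCommutativeSemiringˡ)
open import Data.Fin.Base as Fin using (Fin; zero; suc; toℕ; fromℕ; fromℕ<; inject₁; punchIn; punchOut)
open import Data.Fin.Properties as Fin
  using (any?; punchIn-punchOut; toℕ-fromℕ; toℕ-fromℕ<; toℕ-inject₁; toℕ-injective; toℕ<n)
open import Data.Integer.Base using (ℤ; +_; -[1+_]; -_; _+_; _-_; _*_; _^_; 0ℤ; 1ℤ; -1ℤ; ∣_∣)
open import Data.Integer.DivMod using (_%ℕ_; _/ℕ_; a≡a%ℕn+[a/ℕn]*n; n%ℕd<d)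
open import Data.Integer.Divisibility.Signed
  using (_∣_; divides; _∣?_; ∣ᵤ⇒∣; ∣⇒∣ᵤ; ∣n⇒∣m*n; ∣m∣n⇒∣m+n)
open import Data.Integer.Properties as ℤₚ using ()
open import Data.Integer.Tactic.RingSolver using (solve-∀)
open import Data.Nat.Base as ℕ using (ℕ; zero; suc; _∸_; _≤_; _<_; s≤s)
open import Data.Nat.Combinatorics using (_C_; nC1≡n; nCn≡1; nCk+nC[k+1]≡[n+1]C[k+1])
open import Data.Nat.Divisibility as ℕ∣ using () renaming (_∣_ to _∣ℕ_)
open import Data.Nat.Primality
  using (Prime; euclidsLemma; prime⇒nonTrivial; prime⇒nonZero; ¬prime[0]; ¬prime[1])
open import Data.Nat.Properties as ℕₚ using ()
open import Data.Nat.Tactic.RingSolver as ℕ-Solver using ()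
open import Data.Product.Base using (_×_; ∃-syntax; _,_; proj₁; proj₂)
open import Data.Sum.Base as Sum using (_⊎_; inj₁; inj₂; [_,_]′)
open import Data.Unit.Base using (⊤; tt)
open import Data.Vec.Functional using (Vector; _∷_; head; tail; insertAt)
open import Data.Vec.Functional.Properties using (insertAt-lookup; insertAt-punchIn)
open import Defs
open import Function.Base using (_∘_)
open import Function.Bundles using (_⇔_; mk⇔)
open import Level using (0ℓ)
open import Relation.Binary.Bundles using (Setoid)
open import Relation.Binary.PropositionalEquality
  using (_≡_; _≢_; refl; sym; trans; cong; cong₂; subst; module ≡-Reasoning; isEquivalence)
open import Relation.Binary.Reasoning.Setoid as Setoid-Reasoning using ()
open import Relation.Nullary.Decidable.Core using (Dec; yes; no)
open import Relation.Nullary.Negation.Core using (¬_; contradiction)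

open Semiring-Sum ℤₚ.+-*-semiring
  using (sum; sum-cong-≗; sum-replicate-zero; sum-init-last; ∑-distrib-+; *-distribˡ-sum; *-distribʳ-sum)
open Monoid-Sum ℤₚ.*-1-commutativeMonoid
  using () renaming (sum to product)

-- Both coefficient sequences come from inverting Q on the nonzero residues, that is modulo t^(p-1)
-- - 1. Let α and 1/α be the roots of Q. If they are not residues, Q is a unit there and μ / Q has
-- the coefficients -(α^(k+2) + α^-(k+2)). If they are residues, Q is a zero divisor: μ (Q t)^(p-2)
-- vanishes at them, so Q g equals μ minus μ times the indicator of the roots. The coefficients of
-- that forcing term solve the Lucas recurrence themselves, and this resonance creates the factor k
-- in the first criterion. The multiplier μ = -(c - 2)(c + 2) clears denominators and is a unit.
--
-- The coefficients have the indices 0 to p - 2, but the theorem stops at p - 3. The last one is ±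
-- A, so it only matters for c ≡ 0, when the coefficient of index 1 vanishes as well; that index is
-- in range if p > 3. For p = 3 the assumptions on c leave c ≡ 0, with c² - 4 a nonresidue: there
-- det D_3(0) = -9 is divisible by 3, while k = 0 gives the value 2, so the second criterion would
-- fail. Hence the hypothesis p ≢ 3 in part (2).

module Determinant where

  -- Alternating forms and the multiplicativity of the determinant

  private variable
    m n : ℕ

  punchIn-elim : (j : Fin (suc n)) (P : Fin (suc n) → Set) →
    P j → (∀ k → P (punchIn j k)) → ∀ k → P k
  punchIn-elim j P at off k with j Fin.≟ k
  ... | yes refl = at
  ... | no j≢k   = subst P (punchIn-punchOut j≢k) (off (punchOut j≢k))

  δ : Matrix n
  δ zero    zero    = 1ℤ
  δ zero    (suc _) = 0ℤ
  δ (suc _) zero    = 0ℤ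
  δ (suc i) (suc j) = δ i j

  δ-refl : (i : Fin n) → δ i i ≡ 1ℤ
  δ-refl zero    = refl
  δ-refl (suc i) = δ-refl i

  δ-punchInʳ : (j : Fin (suc n)) (k : Fin n) → δ j (punchIn j k) ≡ 0ℤ
  δ-punchInʳ zero    k       = refl
  δ-punchInʳ (suc j) zero    = refl
  δ-punchInʳ (suc j) (suc k) = δ-punchInʳ j k

  δ-punchInˡ : (j : Fin (suc n)) (k : Fin n) → δ (punchIn j k) j ≡ 0ℤ
  δ-punchInˡ zero    k       = refl
  δ-punchInˡ (suc j) zero    = refl
  δ-punchInˡ (suc j) (suc k) = δ-punchInˡ j k

  δ-punchIn : (j : Fin (suc n)) (i k : Fin n) → δ (punchIn j i) (punchIn j k) ≡ δ i k
  δ-punchIn zero    i       k       = refl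
  δ-punchIn (suc j) zero    zero    = refl
  δ-punchIn (suc j) zero    (suc k) = refl
  δ-punchIn (suc j) (suc i) zero    = refl
  δ-punchIn (suc j) (suc i) (suc k) = δ-punchIn j i k

  sum-zero : (f : Vector ℤ n) → (∀ k → f k ≡ 0ℤ) → sum f ≡ 0ℤ
  sum-zero {n} f f≡0 = trans (sum-cong-≗ f≡0) (sum-replicate-zero n)

  sum-δ : (a : Vector ℤ n) (j : Fin n) → sum (λ k → a k * δ k j) ≡ a j
  sum-δ {suc n} a zero = trans
    (cong₂ _+_ (ℤₚ.*-identityʳ (a zero)) (sum-zero _ λ k → ℤₚ.*-zeroʳ (a (suc k))))
    (ℤₚ.+-identityʳ (a zero))
  sum-δ {suc n} a (suc j) = trans
    (cong₂ _+_ (ℤₚ.*-zeroʳ (a zero)) (sum-δ (a ∘ suc) j))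
    (ℤₚ.+-identityˡ (a (suc j)))

  -- The row length `m` and the number `n` of rows are kept apart: freezing the head row lowers `n`
  -- but not `m`, and the inductions on alternating forms proceed by such freezing.
  Form : ℕ → ℕ → Set
  Form m n = Vector (Vector ℤ m) n → ℤ

  Congruent : Form m n → Set
  Congruent K = ∀ {A B} → (∀ i j → A i j ≡ B i j) → K A ≡ K B

  LinearInHead : Form m (suc n) → Set
  LinearInHead K = ∀ x u v A →
    K ((λ j → x * u j + v j) ∷ A) ≡ x * K (u ∷ A) + K (v ∷ A)

  KillsRepeatedHead : ∀ n → Form m (suc n) → Set
  KillsRepeatedHead zero    K = ⊤
  KillsRepeatedHead (suc n) K = ∀ u A → K (u ∷ u ∷ A) ≡ 0ℤ

  -- Multilinear and zero on two equal adjacent rows.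
  Alternating : ∀ n → Form m n → Set
  Alternating zero    K = Congruent K
  Alternating (suc n) K = Congruent K × LinearInHead K × KillsRepeatedHead n K ×
    (∀ u → Alternating n (λ A → K (u ∷ A)))

  congruent : ∀ n {K : Form m n} → Alternating n K → Congruent K
  congruent zero    K-alt = K-alt
  congruent (suc n) K-alt = proj₁ K-alt

  ∷-cong : {u v : Vector ℤ m} {A B : Vector (Vector ℤ m) n} →
    (∀ j → u j ≡ v j) → (∀ i j → A i j ≡ B i j) → ∀ i j → (u ∷ A) i j ≡ (v ∷ B) i j
  ∷-cong u≡v A≡B zero    = u≡v
  ∷-cong u≡v A≡B (suc i) = A≡B i

  ∷-η : (A : Vector (Vector ℤ m) (suc n)) → ∀ i j → A i j ≡ (head A ∷ tail A) i j
  ∷-η A zero    j = refl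
  ∷-η A (suc i) j = refl

  -- Forms with equal values are not equal as functions, so the property has to be carried over. The
  -- need arises because `f ∘ (u ∷ A)` and `f u ∷ (f ∘ A)` agree only entrywise.
  alternating-resp : ∀ n {K L : Form m n} → (∀ A → K A ≡ L A) → Alternating n K → Alternating n L
  alternating-resp zero K≡L K-cong {A} {B} A≡B =
    trans (sym (K≡L A)) (trans (K-cong A≡B) (K≡L B))
  alternating-resp (suc n) {K} {L} K≡L (K-cong , K-lin , K-rep , K-tail) =
      (λ {A} {B} A≡B → trans (sym (K≡L A)) (trans (K-cong A≡B) (K≡L B)))
    , (λ x u v A → trans (sym (K≡L _)) (trans (K-lin x u v A)
        (cong₂ (λ y z → x * y + z) (K≡L _) (K≡L _))))
    , rep n K≡L K-rep
    , λ u → alternating-resp n (λ A → K≡L (u ∷ A)) (K-tail u)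
    where
    rep : ∀ n {K L : Form m (suc n)} → (∀ A → K A ≡ L A) →
      KillsRepeatedHead n K → KillsRepeatedHead n L
    rep zero    K≡L K-rep = tt
    rep (suc n) K≡L K-rep u A = trans (sym (K≡L _)) (K-rep u A)

  alternating-sum : ∀ n {l} (x : Vector ℤ l) (K : Fin l → Form m n) →
    (∀ i → Alternating n (K i)) → Alternating n (λ A → sum (λ i → x i * K i A))
  alternating-sum zero x K K-alt A≡B = sum-cong-≗ (λ i → cong (x i *_) (K-alt i A≡B))
  alternating-sum (suc n) x K K-alt =
      (λ A≡B → sum-cong-≗ (λ i → cong (x i *_) (proj₁ (K-alt i) A≡B)))
    , (λ y u v A → begin
        sum (λ i → x i * K i ((λ j → y * u j + v j) ∷ A))
          ≡⟨ sum-cong-≗ (λ i → trans (cong (x i *_) (proj₁ (proj₂ (K-alt i)) y u v A))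
               (distrib (x i) y _ _)) ⟩
        sum (λ i → y * (x i * K i (u ∷ A)) + x i * K i (v ∷ A))
          ≡⟨ ∑-distrib-+ (λ i → y * (x i * K i (u ∷ A))) (λ i → x i * K i (v ∷ A)) ⟩
        sum (λ i → y * (x i * K i (u ∷ A))) + sum (λ i → x i * K i (v ∷ A))
          ≡⟨ cong (_+ sum (λ i → x i * K i (v ∷ A))) (*-distribˡ-sum y (λ i → x i * K i (u ∷ A))) ⟨
        y * sum (λ i → x i * K i (u ∷ A)) + sum (λ i → x i * K i (v ∷ A)) ∎)
    , rep n K (λ i → proj₁ (proj₂ (proj₂ (K-alt i))))
    , λ u → alternating-sum n x (λ i A → K i (u ∷ A)) (λ i → proj₂ (proj₂ (proj₂ (K-alt i))) u)
    where
    open ≡-Reasoning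
    distrib : ∀ x y a b → x * (y * a + b) ≡ y * (x * a) + x * b
    distrib = solve-∀
    rep : ∀ n (K : Fin _ → Form _ (suc n)) → (∀ i → KillsRepeatedHead n (K i)) →
      KillsRepeatedHead n (λ A → sum (λ i → x i * K i A))
    rep zero    K K-rep = tt
    rep (suc n) K K-rep u A =
      sum-zero _ λ i → trans (cong (x i *_) (K-rep i u A)) (ℤₚ.*-zeroʳ (x i))

  -- Linear maps applied row by row pull alternating forms back. The instances are the deletion of a
  -- column, the insertion of a zero column and the multiplication by a matrix on the right.
  record RowMap (f : Vector ℤ m → Vector ℤ n) : Set where
    field
      map-cong   : ∀ {u v} → (∀ j → u j ≡ v j) → ∀ j → f u j ≡ f v j
      map-linear : ∀ x u v j → f (λ k → x * u k + v k) j ≡ x * f u j + f v j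

  open RowMap

  alternating-∘ : ∀ n {l} {f : Vector ℤ l → Vector ℤ m} → RowMap f → {K : Form m n} →
    Alternating n K → Alternating n (λ A → K (f ∘ A))
  alternating-∘ zero f-map K-cong _ = K-cong λ ()
  alternating-∘ (suc n) {f = f} f-map {K} (K-cong , K-lin , K-rep , K-tail) =
      (λ A≡B → K-cong (λ i → map-cong f-map (A≡B i)))
    , (λ x u v A → begin
        K (f ∘ ((λ j → x * u j + v j) ∷ A))      ≡⟨ unfold K-cong _ A ⟩
        K (f (λ j → x * u j + v j) ∷ (f ∘ A))    ≡⟨ K-cong (∷-cong (map-linear f-map x u v) (λ _ _ → refl)) ⟩
        K ((λ j → x * f u j + f v j) ∷ (f ∘ A))  ≡⟨ K-lin x (f u) (f v) (f ∘ A) ⟩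
        x * K (f u ∷ (f ∘ A)) + K (f v ∷ (f ∘ A))
          ≡⟨ cong₂ (λ y z → x * y + z) (unfold K-cong u A) (unfold K-cong v A) ⟨
        x * K (f ∘ (u ∷ A)) + K (f ∘ (v ∷ A))    ∎)
    , rep n K-cong K-rep
    , λ u → alternating-resp n (λ A → sym (unfold K-cong u A)) (alternating-∘ n f-map (K-tail (f u)))
    where
    open ≡-Reasoning
    unfold : ∀ {n} {K : Form _ (suc n)} → Congruent K → ∀ u A → K (f ∘ (u ∷ A)) ≡ K (f u ∷ (f ∘ A))
    unfold K-cong u A = K-cong λ { zero _ → refl ; (suc _) _ → refl }
    rep : ∀ n {K : Form _ (suc n)} → Congruent K → KillsRepeatedHead n K →
      KillsRepeatedHead n (λ A → K (f ∘ A))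
    rep zero    K-cong K-rep = tt
    rep (suc n) K-cong K-rep u A = trans
      (K-cong λ { zero _ → refl ; (suc zero) _ → refl ; (suc (suc _)) _ → refl })
      (K-rep (f u) (f ∘ A))

  -- `LinearInHead` has no clause for scaling alone, so the zero row is written as `-1ℤ * u + u` and
  -- the two values cancel.
  head-zero : {K : Form m (suc n)} → Alternating (suc n) K → ∀ u A →
    (∀ j → u j ≡ 0ℤ) → K (u ∷ A) ≡ 0ℤ
  head-zero {K = K} (K-cong , K-lin , _) u A u≡0 = begin
    K (u ∷ A)                              ≡⟨ K-cong (∷-cong (λ j → trans (u≡0 j) (sym (cancel (u j)))) (λ _ _ → refl)) ⟩
    K ((λ j → -1ℤ * u j + u j) ∷ A)        ≡⟨ K-lin -1ℤ u u A ⟩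
    -1ℤ * K (u ∷ A) + K (u ∷ A)            ≡⟨ cancel (K (u ∷ A)) ⟩
    0ℤ                                     ∎
    where
    open ≡-Reasoning
    cancel : ∀ x → -1ℤ * x + x ≡ 0ℤ
    cancel = solve-∀

  head-sum : {K : Form m (suc n)} → Alternating (suc n) K →
    ∀ {l} (x : Vector ℤ l) (v : Vector (Vector ℤ m) l) A →
    K ((λ j → sum (λ k → x k * v k j)) ∷ A) ≡ sum (λ k → x k * K (v k ∷ A))
  head-sum K-alt {zero}  x v A = head-zero K-alt _ A (λ _ → refl)
  head-sum {K = K} K-alt {suc l} x v A = trans
    (proj₁ (proj₂ K-alt) (x zero) (v zero) _ A)
    (cong (λ z → x zero * K (v zero ∷ A) + z) (head-sum K-alt (x ∘ suc) (v ∘ suc) A))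

  swap-head : {K : Form m (suc (suc n))} → Alternating (suc (suc n)) K →
    ∀ u v A → K (u ∷ v ∷ A) ≡ - K (v ∷ u ∷ A)
  swap-head {K = K} (K-cong , K-lin , K-rep , K-tail) u v A = from-zero _ _ (begin
    K (u ∷ v ∷ A) + K (v ∷ u ∷ A)
      ≡⟨ expand (K (u ∷ v ∷ A)) (K (v ∷ u ∷ A)) ⟩
    1ℤ * (1ℤ * 0ℤ + K (u ∷ v ∷ A)) + (1ℤ * K (v ∷ u ∷ A) + 0ℤ)
      ≡⟨ cong₂ (λ y z → 1ℤ * (1ℤ * y + K (u ∷ v ∷ A)) + (1ℤ * K (v ∷ u ∷ A) + z)) (K-rep u A) (K-rep v A) ⟨
    1ℤ * (1ℤ * K (u ∷ u ∷ A) + K (u ∷ v ∷ A)) + (1ℤ * K (v ∷ u ∷ A) + K (v ∷ v ∷ A))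
      ≡⟨ cong₂ (λ y z → 1ℤ * y + z) (proj₁ (proj₂ (K-tail u)) 1ℤ u v A) (proj₁ (proj₂ (K-tail v)) 1ℤ u v A) ⟨
    1ℤ * K (u ∷ w ∷ A) + K (v ∷ w ∷ A)
      ≡⟨ K-lin 1ℤ u v (w ∷ A) ⟨
    K (w ∷ w ∷ A)
      ≡⟨ K-rep w A ⟩
    0ℤ ∎)
    where
    open ≡-Reasoning
    w = λ j → 1ℤ * u j + v j
    expand : ∀ x y → x + y ≡ 1ℤ * (1ℤ * 0ℤ + x) + (1ℤ * y + 0ℤ)
    expand = solve-∀
    regroup : ∀ x y → x ≡ x + y + - y
    regroup = solve-∀
    from-zero : ∀ x y → x + y ≡ 0ℤ → x ≡ - y
    from-zero x y x+y≡0 = trans (regroup x y) (trans (cong (_+ - y) x+y≡0) (ℤₚ.+-identityˡ (- y)))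

  -- Moving the head row down past `j` rows takes `j` transpositions. This is the source of the
  -- cofactor signs.
  insert-head : ∀ n {K : Form m (suc n)} → Alternating (suc n) K → ∀ u A j →
    K (u ∷ A) ≡ -1ℤ ^ toℕ j * K (insertAt A j u)
  insert-head n {K} K-alt u A zero = trans
    (congruent (suc n) K-alt (λ { zero _ → refl ; (suc _) _ → refl })) (sym (ℤₚ.*-identityˡ _))
  insert-head (suc n) {K} K-alt u A (suc j) = begin
    K (u ∷ A)                                               ≡⟨ K-cong (∷-cong (λ _ → refl) (∷-η A)) ⟩
    K (u ∷ head A ∷ tail A)                                 ≡⟨ swap-head K-alt u (head A) (tail A) ⟩
    - K (head A ∷ u ∷ tail A)                               ≡⟨ cong -_ (insert-head n (proj₂ (proj₂ (proj₂ K-alt)) (head A)) u (tail A) j) ⟩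
    - (-1ℤ ^ toℕ j * K (head A ∷ insertAt (tail A) j u))    ≡⟨ cong (λ z → - (-1ℤ ^ toℕ j * z)) (K-cong (λ { zero _ → refl ; (suc _) _ → refl })) ⟩
    - (-1ℤ ^ toℕ j * K (insertAt A (suc j) u))              ≡⟨ signs (-1ℤ ^ toℕ j) _ ⟩
    -1ℤ ^ toℕ (suc j) * K (insertAt A (suc j) u)            ∎
    where
    open ≡-Reasoning
    K-cong = congruent (suc (suc n)) K-alt
    signs : ∀ s x → - (s * x) ≡ -1ℤ * s * x
    signs = solve-∀

  kills-repeated : ∀ n {K : Form m (suc n)} → Alternating (suc n) K → ∀ u A i →
    (∀ j → A i j ≡ u j) → K (u ∷ A) ≡ 0ℤ
  kills-repeated (suc n) {K} K-alt u A zero Ai≡u = trans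
    (congruent (suc (suc n)) K-alt (∷-cong (λ _ → refl) λ { zero → Ai≡u ; (suc _) _ → refl }))
    (proj₁ (proj₂ (proj₂ K-alt)) u (tail A))
  kills-repeated (suc n) {K} K-alt u A (suc i) Ai≡u = begin
    K (u ∷ A)                  ≡⟨ congruent (suc (suc n)) K-alt (∷-cong (λ _ → refl) (∷-η A)) ⟩
    K (u ∷ head A ∷ tail A)    ≡⟨ swap-head K-alt u (head A) (tail A) ⟩
    - K (head A ∷ u ∷ tail A)  ≡⟨ cong -_ (kills-repeated n (proj₂ (proj₂ (proj₂ K-alt)) (head A)) u (tail A) i Ai≡u) ⟩
    0ℤ                         ∎
    where open ≡-Reasoning

  -- Row elimination. `K` is meant to be a form whose head row has already been frozen to `u`; only
  -- the resulting property `kills` is assumed, which survives when the induction freezes further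
  -- rows.
  subtract-row : ∀ n {K : Form m n} → Alternating n K → ∀ (u : Vector ℤ m) →
    (∀ A i → (∀ j → A i j ≡ u j) → K A ≡ 0ℤ) →
    ∀ (x : Vector ℤ n) A → K (λ i j → x i * u j + A i j) ≡ K A
  subtract-row zero    K-cong u kills x A = K-cong λ ()
  subtract-row (suc n) {K} (K-cong , K-lin , _ , K-tail) u kills x A = begin
    K B                                            ≡⟨ K-cong (∷-η B) ⟩
    K (head B ∷ tail B)                            ≡⟨ K-lin (x zero) u (head A) (tail B) ⟩
    x zero * K (u ∷ tail B) + K (head A ∷ tail B)  ≡⟨ cong (λ z → x zero * z + K (head A ∷ tail B)) (kills (u ∷ tail B) zero (λ _ → refl)) ⟩
    x zero * 0ℤ + K (head A ∷ tail B)              ≡⟨ cong (_+ K (head A ∷ tail B)) (ℤₚ.*-zeroʳ (x zero)) ⟩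
    0ℤ + K (head A ∷ tail B)                       ≡⟨ ℤₚ.+-identityˡ _ ⟩
    K (head A ∷ tail B)                            ≡⟨ subtract-row n (K-tail (head A)) u (λ C i → kills (head A ∷ C) (suc i)) (tail x) (tail A) ⟩
    K (head A ∷ tail A)                            ≡⟨ K-cong (∷-η A) ⟨
    K A                                            ∎
    where
    open ≡-Reasoning
    B : Vector (Vector ℤ _) (suc n)
    B i j = x i * u j + A i j

  minor : Matrix (suc n) → Fin (suc n) → Matrix n
  minor A j i k = A (suc i) (punchIn j k)

  pad : Fin (suc n) → Vector ℤ n → Vector ℤ (suc n)
  pad j v = insertAt v j 0ℤ

  pad-rowMap : (j : Fin (suc n)) → RowMap (pad j)
  pad-rowMap j .map-cong {u} {v} u≡v = punchIn-elim j (λ k → pad j u k ≡ pad j v k)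
    (trans (insertAt-lookup u j 0ℤ) (sym (insertAt-lookup v j 0ℤ)))
    (λ k → trans (insertAt-punchIn u j 0ℤ k) (trans (u≡v k) (sym (insertAt-punchIn v j 0ℤ k))))
  pad-rowMap j .map-linear x u v = punchIn-elim j
    (λ k → pad j (λ k → x * u k + v k) k ≡ x * pad j u k + pad j v k)
    (trans (insertAt-lookup _ j 0ℤ) (sym (trans
      (cong₂ (λ y z → x * y + z) (insertAt-lookup u j 0ℤ) (insertAt-lookup v j 0ℤ))
      (trans (ℤₚ.+-identityʳ (x * 0ℤ)) (ℤₚ.*-zeroʳ x)))))
    (λ k → trans (insertAt-punchIn _ j 0ℤ k) (sym
      (cong₂ (λ y z → x * y + z) (insertAt-punchIn u j 0ℤ k) (insertAt-punchIn v j 0ℤ k))))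

  row-split : (a : Vector ℤ (suc n)) (j : Fin (suc n)) → ∀ k →
    a k ≡ a j * δ j k + pad j (a ∘ punchIn j) k
  row-split a j = punchIn-elim j (λ k → a k ≡ a j * δ j k + pad j (a ∘ punchIn j) k)
    (sym (trans (cong₂ (λ y z → a j * y + z) (δ-refl j) (insertAt-lookup (a ∘ punchIn j) j 0ℤ))
      (trans (ℤₚ.+-identityʳ _) (ℤₚ.*-identityʳ (a j)))))
    (λ k → sym (trans (cong₂ (λ y z → a j * y + z) (δ-punchInʳ j k) (insertAt-punchIn (a ∘ punchIn j) j 0ℤ k))
      (trans (cong (_+ a (punchIn j k)) (ℤₚ.*-zeroʳ (a j))) (ℤₚ.+-identityˡ _))))

  insertAt-δ : (j : Fin (suc n)) → ∀ i k → insertAt (λ i → pad j (δ i)) j (δ j) i k ≡ δ i k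
  insertAt-δ {n} j = punchIn-elim j (λ i → ∀ k → insertAt rows j (δ j) i k ≡ δ i k)
    (λ k → cong (λ r → r k) (insertAt-lookup rows j (δ j)))
    (λ i → punchIn-elim j (λ k → insertAt rows j (δ j) (punchIn j i) k ≡ δ (punchIn j i) k)
      (trans (row i j) (trans (insertAt-lookup (δ i) j 0ℤ) (sym (δ-punchInˡ j i))))
      (λ k → trans (row i (punchIn j k)) (trans (insertAt-punchIn (δ i) j 0ℤ k) (sym (δ-punchIn j i k)))))
    where
    rows : Vector (Vector ℤ (suc n)) n
    rows i = pad j (δ i)
    row : ∀ i k → insertAt rows j (δ j) (punchIn j i) k ≡ rows i k
    row i k = cong (λ r → r k) (insertAt-punchIn rows j (δ j) i)

  -- The first row is expanded in unit vectors. With `δ j` on top, column `j` can be cleared from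
  -- the other rows, and what remains is an alternating form in the minor, to which induction
  -- applies. Its value at the identity differs from `F δ` by the sign of moving `δ j` from the top
  -- to position `j`, so the sum becomes the Laplace expansion.
  alternating-unique : ∀ n {F : Form n n} → Alternating n F → ∀ A → F A ≡ det n A * F δ
  alternating-unique zero F-cong A = trans (F-cong λ ()) (sym (ℤₚ.*-identityˡ _))
  alternating-unique (suc n) {F} F-alt@(F-cong , _ , _ , F-tail) A = begin
    F A
      ≡⟨ F-cong (λ { zero j → sym (sum-δ (head A) j) ; (suc _) _ → refl }) ⟩
    F ((λ j → sum (λ k → head A k * δ k j)) ∷ tail A)
      ≡⟨ head-sum F-alt (head A) δ (tail A) ⟩
    sum (λ j → head A j * F (δ j ∷ tail A))
      ≡⟨ sum-cong-≗ (λ j → trans (cong (head A j *_) (at j)) (regroup (head A j) (det n (minor A j)) (-1ℤ ^ toℕ j) (F δ))) ⟩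
    sum (λ j → -1ℤ ^ toℕ j * head A j * det n (minor A j) * F δ)
      ≡⟨ *-distribʳ-sum (F δ) (λ j → -1ℤ ^ toℕ j * head A j * det n (minor A j)) ⟨
    det (suc n) A * F δ ∎
    where
    open ≡-Reasoning
    regroup : ∀ a d s f → a * (d * (s * f)) ≡ s * a * d * f
    regroup = solve-∀
    at : ∀ j → F (δ j ∷ tail A) ≡ det n (minor A j) * (-1ℤ ^ toℕ j * F δ)
    at j = begin
      F (δ j ∷ tail A)
        ≡⟨ F-cong (∷-cong (λ _ → refl) (λ i → row-split (A (suc i)) j)) ⟩
      F (δ j ∷ (λ i k → A (suc i) j * δ j k + pad j (minor A j i) k))
        ≡⟨ subtract-row n (F-tail (δ j)) (δ j) (kills-repeated n F-alt (δ j)) (λ i → A (suc i) j) (pad j ∘ minor A j) ⟩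
      F (δ j ∷ (pad j ∘ minor A j))
        ≡⟨ alternating-unique n (alternating-∘ n (pad-rowMap j) (F-tail (δ j))) (minor A j) ⟩
      det n (minor A j) * F (δ j ∷ (pad j ∘ δ))
        ≡⟨ cong (det n (minor A j) *_) (insert-head n F-alt (δ j) (pad j ∘ δ) j) ⟩
      det n (minor A j) * (-1ℤ ^ toℕ j * F (insertAt (pad j ∘ δ) j (δ j)))
        ≡⟨ cong (λ z → det n (minor A j) * (-1ℤ ^ toℕ j * z)) (F-cong (insertAt-δ j)) ⟩
      det n (minor A j) * (-1ℤ ^ toℕ j * F δ) ∎

  -- The terms for the columns (j , l) and (l , j) cancel; the pairs containing
  -- column 0 are paired off first.
  pairs-cancel : ∀ n (a : Vector ℤ (suc (suc n))) (d : (Fin n → Fin (suc (suc n))) → ℤ) →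
    (∀ g h → (∀ k → g k ≡ h k) → d g ≡ d h) →
    sum (λ j → sum (λ k → -1ℤ ^ toℕ j * a j *
      (-1ℤ ^ toℕ k * a (punchIn j k) * d (punchIn j ∘ punchIn k)))) ≡ 0ℤ
  pairs-cancel n a d d-cong = begin
    sum (f zero) + sum (λ j → f (suc j) zero + sum (λ k → f (suc j) (suc k)))
      ≡⟨ cong (λ z → sum (f zero) + z) (∑-distrib-+ (λ j → f (suc j) zero) (λ j → sum (λ k → f (suc j) (suc k)))) ⟩
    sum (f zero) + (sum (λ j → f (suc j) zero) + sum (λ j → sum (λ k → f (suc j) (suc k))))
      ≡⟨ ℤₚ.+-assoc (sum (f zero)) _ _ ⟨
    sum (f zero) + sum (λ j → f (suc j) zero) + sum (λ j → sum (λ k → f (suc j) (suc k)))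
      ≡⟨ cong₂ _+_ (sym (∑-distrib-+ (f zero) (λ j → f (suc j) zero))) (rest n a d d-cong) ⟩
    sum (λ k → f zero k + f (suc k) zero) + 0ℤ
      ≡⟨ cong (_+ 0ℤ) (sum-zero _ (λ k → opposite (-1ℤ ^ toℕ k) (a zero) (a (suc k)) (d (punchIn zero ∘ punchIn k)) _
        (d-cong _ (punchIn (suc k) ∘ punchIn zero) (λ _ → refl)))) ⟩
    0ℤ ∎
    where
    open ≡-Reasoning
    f : Fin (suc (suc n)) → Fin (suc n) → ℤ
    f j k = -1ℤ ^ toℕ j * a j * (-1ℤ ^ toℕ k * a (punchIn j k) * d (punchIn j ∘ punchIn k))
    opposite : ∀ s x y d e → d ≡ e →
      1ℤ * x * (s * y * d) + -1ℤ * s * y * (1ℤ * x * e) ≡ 0ℤ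
    opposite s x y d .d refl = identity s x y d
      where
      identity : ∀ s x y d → 1ℤ * x * (s * y * d) + -1ℤ * s * y * (1ℤ * x * d) ≡ 0ℤ
      identity = solve-∀
    rest : ∀ n (a : Vector ℤ (suc (suc n))) (d : (Fin n → Fin (suc (suc n))) → ℤ) →
      (∀ g h → (∀ k → g k ≡ h k) → d g ≡ d h) →
      sum {suc n} (λ j → sum {n} (λ k → -1ℤ ^ toℕ (suc j) * a (suc j) *
        (-1ℤ ^ toℕ (suc k) * a (suc (punchIn j k)) * d (punchIn (suc j) ∘ punchIn (suc k))))) ≡ 0ℤ
    rest zero    a d d-cong = refl
    rest (suc n) a d d-cong = trans
      (sum-cong-≗ λ j → sum-cong-≗ λ k → trans
        (cong (λ z → -1ℤ ^ toℕ (suc j) * a (suc j) * (-1ℤ ^ toℕ (suc k) * a (suc (punchIn j k)) * z))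
          (d-cong (punchIn (suc j) ∘ punchIn (suc k)) (lift (punchIn j ∘ punchIn k))
            (λ { zero → refl ; (suc _) → refl })))
        (signs (-1ℤ ^ toℕ j) (a (suc j)) (-1ℤ ^ toℕ k) (a (suc (punchIn j k)))
          (d (lift (punchIn j ∘ punchIn k)))))
      (pairs-cancel n (a ∘ suc) (d ∘ lift)
        (λ g h g≡h → d-cong (lift g) (lift h) (λ { zero → refl ; (suc k) → cong suc (g≡h k) })))
      where
      lift : (Fin n → Fin (suc (suc n))) → Fin (suc n) → Fin (suc (suc (suc n)))
      lift g zero    = zero
      lift g (suc k) = suc (g k)
      signs : ∀ s x t y d → -1ℤ * s * x * (-1ℤ * t * y * d) ≡ s * x * (t * y * d)
      signs = solve-∀

  det-cong : ∀ n → Congruent (det n)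
  det-cong zero    A≡B = refl
  det-cong (suc n) A≡B = sum-cong-≗ λ j →
    cong₂ (λ y z → -1ℤ ^ toℕ j * y * z) (A≡B zero j) (det-cong n (λ i k → A≡B (suc i) (punchIn j k)))

  -- Once the first row is frozen, the determinant is a combination of smaller determinants with a
  -- column deleted, hence alternating by induction. Only two equal top rows need another argument:
  -- expanding along both gives the double sum of `pairs-cancel`.
  det-alternating : ∀ n → Alternating n (det n)
  det-alternating zero    = det-cong zero
  det-alternating (suc n) =
      det-cong (suc n)
    , linear
    , repeated n
    , λ u → alternating-sum n (λ j → -1ℤ ^ toℕ j * u j) _
        (λ j → alternating-∘ n (punchIn-rowMap j) (det-alternating n))
    where
    open ≡-Reasoning
    punchIn-rowMap : ∀ j → RowMap (_∘ punchIn j)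
    punchIn-rowMap j .map-cong u≡v k = u≡v (punchIn j k)
    punchIn-rowMap j .map-linear x u v k = refl
    distrib : ∀ s x u v d → s * (x * u + v) * d ≡ x * (s * u * d) + s * v * d
    distrib = solve-∀
    linear : LinearInHead (det (suc n))
    linear x u v A = begin
      det (suc n) ((λ j → x * u j + v j) ∷ A)
        ≡⟨ sum-cong-≗ (λ j → distrib (-1ℤ ^ toℕ j) x (u j) (v j) (det n (λ i k → A i (punchIn j k)))) ⟩
      sum (λ j → x * term u j + term v j)
        ≡⟨ ∑-distrib-+ (λ j → x * term u j) (term v) ⟩
      sum (λ j → x * term u j) + det (suc n) (v ∷ A)
        ≡⟨ cong (_+ det (suc n) (v ∷ A)) (*-distribˡ-sum x (term u)) ⟨
      x * det (suc n) (u ∷ A) + det (suc n) (v ∷ A) ∎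
      where
      term : Vector ℤ (suc n) → Vector ℤ (suc n)
      term u j = -1ℤ ^ toℕ j * u j * det n (λ i k → A i (punchIn j k))
    repeated : ∀ n → KillsRepeatedHead n (det (suc n))
    repeated zero = tt
    repeated (suc n) u A = trans
      (sum-cong-≗ λ j → *-distribˡ-sum (-1ℤ ^ toℕ j * u j)
        (λ k → -1ℤ ^ toℕ k * u (punchIn j k) * det n (λ i l → A i (punchIn j (punchIn k l)))))
      (pairs-cancel n u (λ g → det n (λ i l → A i (g l)))
        (λ g h g≡h → det-cong n (λ i l → cong (A i) (g≡h l))))

  infixl 7 _⊗_

  _⊗_ : Matrix n → Matrix n → Matrix n
  (A ⊗ B) i j = sum λ k → A i k * B k j

  ⊗-identityˡ : ∀ {n} (B : Matrix n) i j → (δ ⊗ B) i j ≡ B i j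
  ⊗-identityˡ B i j = trans (sum-cong-≗ (λ k → δ-comm i k (B k j))) (sum-δ (λ k → B k j) i)
    where
    δ-comm : ∀ {n} (i k : Fin n) b → δ i k * b ≡ b * δ k i
    δ-comm zero    zero    b = ℤₚ.*-comm 1ℤ b
    δ-comm zero    (suc k) b = ℤₚ.*-comm 0ℤ b
    δ-comm (suc i) zero    b = ℤₚ.*-comm 0ℤ b
    δ-comm (suc i) (suc k) b = δ-comm i k b

  -- For fixed `B` the form sending `A` to `det n (A ⊗ B)` is alternating, so it is `det n A` times
  -- its value at the identity.
  det-⊗ : ∀ n (A B : Matrix n) → det n (A ⊗ B) ≡ det n A * det n B
  det-⊗ n A B = trans
    (alternating-unique n (alternating-∘ n ⊗-rowMap (det-alternating n)) A)
    (cong (det n A *_) (det-cong n (⊗-identityˡ B)))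
    where
    ⊗-rowMap : RowMap (λ u j → sum (λ k → u k * B k j))
    ⊗-rowMap .map-cong u≡v j = sum-cong-≗ (λ k → cong (_* B k j) (u≡v k))
    ⊗-rowMap .map-linear x u v j = trans
      (sum-cong-≗ (λ k → distrib x (u k) (v k) (B k j)))
      (trans (∑-distrib-+ (λ k → x * (u k * B k j)) (λ k → v k * B k j))
        (cong (_+ sum (λ k → v k * B k j)) (sym (*-distribˡ-sum x (λ k → u k * B k j)))))
      where
      distrib : ∀ x u v b → (x * u + v) * b ≡ x * (u * b) + v * b
      distrib = solve-∀

  det-head-row : ∀ n (A : Matrix (suc n)) → (∀ j → A zero (suc j) ≡ 0ℤ) →
    det (suc n) A ≡ A zero zero * det n (λ i j → A (suc i) (suc j))
  det-head-row n A A≡0 = trans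
    (cong₂ _+_ (cong (_* det n (minor A zero)) (ℤₚ.*-identityˡ (A zero zero)))
      (sum-zero _ (λ j → trans
        (cong (λ z → -1ℤ ^ toℕ (suc j) * z * det n (minor A (suc j))) (A≡0 j))
        (cong (_* det n (minor A (suc j))) (ℤₚ.*-zeroʳ (-1ℤ ^ toℕ (suc j)))))))
    (ℤₚ.+-identityʳ _)

  diagonal : Vector ℤ n → Matrix n
  diagonal x i j = x i * δ i j

  det-diagonal : ∀ n (x : Vector ℤ n) → det n (diagonal x) ≡ product x
  det-diagonal zero    x = refl
  det-diagonal (suc n) x = trans
    (det-head-row n (diagonal x) (λ j → ℤₚ.*-zeroʳ (x zero)))
    (cong₂ _*_ (ℤₚ.*-identityʳ (x zero)) (det-diagonal n (x ∘ suc)))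

  det-scale-rows : ∀ n x (A : Matrix n) → det n (λ i j → x i * A i j) ≡ product x * det n A
  det-scale-rows n x A = begin
    det n (λ i j → x i * A i j)  ≡⟨ det-cong n entry ⟨
    det n (diagonal x ⊗ A)       ≡⟨ det-⊗ n (diagonal x) A ⟩
    det n (diagonal x) * det n A ≡⟨ cong (_* det n A) (det-diagonal n x) ⟩
    product x * det n A          ∎
    where
    open ≡-Reasoning
    entry : ∀ i j → (diagonal x ⊗ A) i j ≡ x i * A i j
    entry i j = trans (sum-cong-≗ (λ k → ℤₚ.*-assoc (x i) (δ i k) (A k j)))
      (trans (sym (*-distribˡ-sum (x i) (λ k → δ i k * A k j))) (cong (x i *_) (⊗-identityˡ A i j)))

  det-scale-columns : ∀ n x (A : Matrix n) → det n (λ i j → A i j * x j) ≡ det n A * product x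
  det-scale-columns n x A = begin
    det n (λ i j → A i j * x j)  ≡⟨ det-cong n entry ⟨
    det n (A ⊗ diagonal x)       ≡⟨ det-⊗ n A (diagonal x) ⟩
    det n A * det n (diagonal x) ≡⟨ cong (det n A *_) (det-diagonal n x) ⟩
    det n A * product x          ∎
    where
    open ≡-Reasoning
    entry : ∀ i j → (A ⊗ diagonal x) i j ≡ A i j * x j
    entry i j = trans (sum-cong-≗ (λ k → sym (ℤₚ.*-assoc (A i k) (x k) (δ k j))))
      (sum-δ (λ k → A i k * x k) j)

  det-δ : ∀ n → det n δ ≡ 1ℤ
  det-δ zero    = refl
  det-δ (suc n) = trans (det-head-row n δ (λ _ → refl)) (trans (ℤₚ.*-identityˡ (det n δ)) (det-δ n))

  -- General in k ≡ l: at refl, the conclusion would be checked by unfolding both determinants.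
  det-transport : ∀ {k l} (k≡l : k ≡ l) (M : Matrix k) (N : Matrix l) →
    (∀ i j → M i j ≡ N (subst Fin k≡l i) (subst Fin k≡l j)) → det k M ≡ det l N
  det-transport {k} refl M N M≡N = det-cong k M≡N

open Determinant

-- The Frobenius congruence

C-absorption : ∀ n k → suc k ℕ.* (suc n C suc k) ≡ suc n ℕ.* (n C k)
C-absorption zero    zero    = refl
C-absorption zero    (suc k) = ℕₚ.*-zeroʳ (suc (suc k))
C-absorption (suc n) zero    = trans (ℕₚ.*-identityˡ (suc (suc n) C 1))
  (trans (nC1≡n (suc (suc n))) (sym (ℕₚ.*-identityʳ (suc (suc n)))))
C-absorption (suc n) (suc k) = begin
  suc (suc k) ℕ.* (suc (suc n) C suc (suc k))
    ≡⟨ cong (suc (suc k) ℕ.*_) (nCk+nC[k+1]≡[n+1]C[k+1] (suc n) (suc k)) ⟨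
  suc (suc k) ℕ.* ((suc n C suc k) ℕ.+ (suc n C suc (suc k)))
    ≡⟨ expand k (suc n C suc k) (suc n C suc (suc k)) ⟩
  (suc n C suc k) ℕ.+ suc k ℕ.* (suc n C suc k) ℕ.+ suc (suc k) ℕ.* (suc n C suc (suc k))
    ≡⟨ cong₂ (λ x y → (suc n C suc k) ℕ.+ x ℕ.+ y) (C-absorption n k) (C-absorption n (suc k)) ⟩
  (suc n C suc k) ℕ.+ suc n ℕ.* (n C k) ℕ.+ suc n ℕ.* (n C suc k)
    ≡⟨ collect n (suc n C suc k) (n C k) (n C suc k) ⟩
  (suc n C suc k) ℕ.+ suc n ℕ.* ((n C k) ℕ.+ (n C suc k))
    ≡⟨ cong (λ x → (suc n C suc k) ℕ.+ suc n ℕ.* x) (nCk+nC[k+1]≡[n+1]C[k+1] n k) ⟩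
  suc (suc n) ℕ.* (suc n C suc k) ∎
  where
  open ≡-Reasoning
  expand : ∀ k x y → suc (suc k) ℕ.* (x ℕ.+ y) ≡ x ℕ.+ suc k ℕ.* x ℕ.+ suc (suc k) ℕ.* y
  expand = ℕ-Solver.solve-∀
  collect : ∀ n w x y → w ℕ.+ suc n ℕ.* x ℕ.+ suc n ℕ.* y ≡ w ℕ.+ suc n ℕ.* (x ℕ.+ y)
  collect = ℕ-Solver.solve-∀

-- By absorption the prime divides `suc k` times the binomial coefficient, and it is too large to
-- divide `suc k`.
prime∣C : ∀ {n} → Prime (suc n) → ∀ {k} → suc k < suc n → suc n ∣ℕ (suc n C suc k)
prime∣C {n} p-prime {k} k<n
  with euclidsLemma (suc k) (suc n C suc k) p-prime
         (ℕ∣.divides (n C k) (trans (C-absorption n k) (ℕₚ.*-comm (suc n) (n C k))))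
... | inj₁ p∣k = contradiction (ℕ∣.∣⇒≤ p∣k) (ℕₚ.<⇒≱ k<n)
... | inj₂ p∣C = p∣C

module _ {a ℓ} (S : CommutativeSemiring a ℓ) where
  open CommutativeSemiring S using (Carrier; _≈_; semiring; setoid; +-commutativeMonoid;
    +-cong; +-congʳ; +-congˡ; *-identityˡ; *-identityʳ; +-comm; +-assoc; reflexive)
    renaming (_+_ to _⊞_; _*_ to _⊠_; trans to ≈-trans; sym to ≈-sym; refl to ≈-refl)
  open Binomial S using (binomialTerm; theorem)
  open Exp semiring using () renaming (_^_ to _^^_)
  open Mult +-commutativeMonoid using (×-congʳ; ×-assocˡ; ×-distrib-+; ×-homo-1; ×-congˡ)
    renaming (_×_ to _⨯_)
  open Semiring-Sum semiring using () renaming (sum to ∑; sum-init-last to ∑-init-last)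

  ∑-multiple : ∀ {l} n (f : Fin l → Carrier) → (∀ k → ∃[ z ] f k ≈ n ⨯ z) → ∃[ z ] ∑ f ≈ n ⨯ z
  ∑-multiple {zero}  n f f-multiple = 0# , ≈-sym (zero-multiple n)
    where
    open CommutativeSemiring S using (0#; +-identityˡ)
    zero-multiple : ∀ n → n ⨯ 0# ≈ 0#
    zero-multiple zero    = ≈-refl
    zero-multiple (suc n) = ≈-trans (+-identityˡ _) (zero-multiple n)
  ∑-multiple {suc l} n f f-multiple with f-multiple zero | ∑-multiple n (λ k → f (suc k)) (λ k → f-multiple (suc k))
  ... | y , f0≈ny | z , Σf≈nz = y ⊞ z , ≈-trans (+-cong f0≈ny Σf≈nz) (≈-sym (×-distrib-+ y z n))

  frobenius : ∀ {p} → Prime p → ∀ x y → ∃[ z ] (x ⊞ y) ^^ p ≈ x ^^ p ⊞ y ^^ p ⊞ p ⨯ z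
  frobenius {suc n} p-prime x y with ∑-multiple (suc n) (λ k → term (suc (inject₁ k))) inner
    where
    term = binomialTerm x y (suc n)
    inner : ∀ k → ∃[ z ] term (suc (inject₁ k)) ≈ suc n ⨯ z
    inner k with prime∣C p-prime (s≤s (subst (_< n) (sym (toℕ-inject₁ k)) (toℕ<n k)))
    ... | ℕ∣.divides q C≡qp = q ⨯ b , ≈-trans
          (×-congˡ (trans C≡qp (ℕₚ.*-comm q (suc n)))) (≈-sym (×-assocˡ b (suc n) q))
      where b = (x ^^ toℕ (suc (inject₁ k))) ⊠ (y ^^ (suc n ∸ toℕ (suc (inject₁ k))))
  ... | z , inner≈pz = z , (begin
    (x ⊞ y) ^^ suc n                                  ≈⟨ theorem (suc n) x y ⟩
    term zero ⊞ ∑ (λ k → term (suc k))             ≈⟨ +-cong first (≈-trans (∑-init-last (λ k → term (suc k))) (+-cong inner≈pz last)) ⟩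
    y ^^ suc n ⊞ (suc n ⨯ z ⊞ x ^^ suc n)              ≈⟨ +-congˡ (+-comm _ _) ⟩
    y ^^ suc n ⊞ (x ^^ suc n ⊞ suc n ⨯ z)              ≈⟨ +-assoc _ _ _ ⟨
    y ^^ suc n ⊞ x ^^ suc n ⊞ suc n ⨯ z                ≈⟨ +-congʳ (+-comm _ _) ⟩
    x ^^ suc n ⊞ y ^^ suc n ⊞ suc n ⨯ z                ∎)
    where
    open Setoid-Reasoning setoid
    term = binomialTerm x y (suc n)
    first : term zero ≈ y ^^ suc n
    first = ≈-trans (×-homo-1 _) (*-identityˡ (y ^^ suc n))
    last : term (suc (fromℕ n)) ≈ x ^^ suc n
    last = ≈-trans
      (×-congˡ (trans (cong (λ k → suc n C suc k) (toℕ-fromℕ n)) (nCn≡1 (suc n))))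
      (≈-trans (×-homo-1 _)
        (≈-trans (reflexive (cong₂ (λ k l → x ^^ suc k ⊠ y ^^ l) (toℕ-fromℕ n)
            (trans (cong (n ∸_) (toℕ-fromℕ n)) (ℕₚ.n∸n≡0 n))))
          (*-identityʳ (x ^^ suc n))))

-- Congruences and Fermat's theorem

module Modular (p : ℕ) where

  infix 4 _≈_ _≉_

  -- A record, so that both sides can be inferred from a proof.
  record _≈_ (a b : ℤ) : Set where
    constructor congruence
    field congruent-mod : a ≡ b [mod p ]

  open _≈_ public

  _≉_ : ℤ → ℤ → Set
  a ≉ b = ¬ (a ≈ b)

  -- The form of nearly all later congruence proofs: `x - y` is exhibited as a combination of
  -- differences already known to be divisible by `p`. The multipliers `q` are the cofactors in that
  -- combination, found by polynomial division, and the ring solver checks the resulting identity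
  -- over ℤ.
  ≈-by₁ : ∀ {a b x y} → a ≈ b → ∀ q → x ≡ y + q * (a - b) → x ≈ y
  ≈-by₁ {a} {b} {_} {y} (congruence p∣a-b) q refl =
    congruence (subst (+ p ∣_) (cancel y (q * (a - b))) (∣n⇒∣m*n q p∣a-b))
    where
    cancel : ∀ y z → z ≡ y + z - y
    cancel = solve-∀

  ≈-reflexive : ∀ {x y} → x ≡ y → x ≈ y
  ≈-reflexive {x} refl = congruence (divides 0ℤ (ℤₚ.+-inverseʳ x))

  ≈-refl : ∀ {x} → x ≈ x
  ≈-refl = ≈-reflexive refl

  ≈-sym : ∀ {x y} → x ≈ y → y ≈ x
  ≈-sym {x} {y} x≈y = ≈-by₁ x≈y -1ℤ (identity x y)
    where
    identity : ∀ x y → y ≡ x + -1ℤ * (x - y)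
    identity = solve-∀

  ≈-trans : ∀ {x y z} → x ≈ y → y ≈ z → x ≈ z
  ≈-trans {x} {y} {z} (congruence p∣x-y) (congruence p∣y-z) =
    congruence (subst (+ p ∣_) (identity x y z) (∣m∣n⇒∣m+n p∣x-y p∣y-z))
    where
    identity : ∀ x y z → (x - y) + (y - z) ≡ x - z
    identity = solve-∀

  ≈-by₂ : ∀ {a b a′ b′ x y} → a ≈ b → ∀ q → a′ ≈ b′ → ∀ q′ →
    x ≡ y + q * (a - b) + q′ * (a′ - b′) → x ≈ y
  ≈-by₂ a≈b q a′≈b′ q′ x≡ = ≈-trans (≈-by₁ a′≈b′ q′ x≡) (≈-by₁ a≈b q refl)

  ≈-by₃ : ∀ {a b a′ b′ a″ b″ x y} → a ≈ b → ∀ q → a′ ≈ b′ → ∀ q′ → a″ ≈ b″ → ∀ q″ →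
    x ≡ y + q * (a - b) + q′ * (a′ - b′) + q″ * (a″ - b″) → x ≈ y
  ≈-by₃ a≈b q a′≈b′ q′ a″≈b″ q″ x≡ =
    ≈-trans (≈-by₁ a″≈b″ q″ x≡) (≈-by₂ a≈b q a′≈b′ q′ refl)

  ≈-setoid : Setoid 0ℓ 0ℓ
  ≈-setoid = record
    { Carrier = ℤ ; _≈_ = _≈_
    ; isEquivalence = record { refl = ≈-refl ; sym = ≈-sym ; trans = ≈-trans } }

  module ≈-Reasoning = Setoid-Reasoning ≈-setoid

  +-cong : ∀ {a b c d} → a ≈ b → c ≈ d → a + c ≈ b + d
  +-cong {a} {b} {c} {d} a≈b c≈d = ≈-by₂ a≈b 1ℤ c≈d 1ℤ (identity a b c d)
    where
    identity : ∀ a b c d → a + c ≡ b + d + 1ℤ * (a - b) + 1ℤ * (c - d)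
    identity = solve-∀

  *-cong : ∀ {a b c d} → a ≈ b → c ≈ d → a * c ≈ b * d
  *-cong {a} {b} {c} {d} a≈b c≈d = ≈-by₂ a≈b c c≈d b (identity a b c d)
    where
    identity : ∀ a b c d → a * c ≡ b * d + c * (a - b) + b * (c - d)
    identity = solve-∀

  *-congˡ : ∀ {a b} c → a ≈ b → c * a ≈ c * b
  *-congˡ c = *-cong (≈-refl {c})

  *-congʳ : ∀ {a b} c → a ≈ b → a * c ≈ b * c
  *-congʳ c a≈b = *-cong a≈b (≈-refl {c})

  ^-cong : ∀ {a b} n → a ≈ b → a ^ n ≈ b ^ n
  ^-cong zero    a≈b = ≈-refl
  ^-cong (suc n) a≈b = *-cong a≈b (^-cong n a≈b)

  sum-cong : ∀ {n} {f g : Vector ℤ n} → (∀ i → f i ≈ g i) → sum f ≈ sum g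
  sum-cong {zero}  f≈g = ≈-refl
  sum-cong {suc n} f≈g = +-cong (f≈g zero) (sum-cong (λ i → f≈g (suc i)))

  det-cong-mod : ∀ n {A B : Matrix n} → (∀ i j → A i j ≈ B i j) → det n A ≈ det n B
  det-cong-mod zero    A≈B = ≈-refl
  det-cong-mod (suc n) A≈B = sum-cong λ j →
    *-cong (*-congˡ (-1ℤ ^ toℕ j) (A≈B zero j)) (det-cong-mod n (λ i k → A≈B (suc i) (punchIn j k)))

  det-zero-column : ∀ n (A : Matrix (suc n)) → (∀ i → A i zero ≈ 0ℤ) → det (suc n) A ≈ 0ℤ
  det-zero-column n A A≈0 = ≈-trans (sum-cong (term n A A≈0)) (≈-reflexive (sum-replicate-zero (suc n)))
    where
    term : ∀ n (A : Matrix (suc n)) → (∀ i → A i zero ≈ 0ℤ) →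
      ∀ j → -1ℤ ^ toℕ j * A zero j * det n (λ i k → A (suc i) (punchIn j k)) ≈ 0ℤ
    term n A A≈0 zero =
      *-congʳ (det n (λ i k → A (suc i) (suc k))) (*-congˡ 1ℤ (A≈0 zero))
    term (suc n) A A≈0 (suc j) = ≈-trans
      (*-congˡ (-1ℤ ^ toℕ (suc j) * A zero (suc j))
        (det-zero-column n (λ i k → A (suc i) (punchIn (suc j) k)) (λ i → A≈0 (suc i))))
      (≈-reflexive (ℤₚ.*-zeroʳ (-1ℤ ^ toℕ (suc j) * A zero (suc j))))

  ∣⇒≈0 : ∀ {x} → + p ∣ x → x ≈ 0ℤ
  ∣⇒≈0 {x} p∣x = congruence (subst (+ p ∣_) (sym (ℤₚ.+-identityʳ x)) p∣x)

  ≈0⇒∣ : ∀ {x} → x ≈ 0ℤ → + p ∣ x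
  ≈0⇒∣ {x} (congruence p∣x-0) = subst (+ p ∣_) (ℤₚ.+-identityʳ x) p∣x-0

  p≈0 : + p ≈ 0ℤ
  p≈0 = ∣⇒≈0 (divides 1ℤ (sym (ℤₚ.*-identityˡ (+ p))))

  p-multiple : ∀ x → + p * x ≈ 0ℤ
  p-multiple x = *-congʳ x p≈0

  difference : ∀ {x y} → x - y ≈ 0ℤ → x ≈ y
  difference {x} {y} x-y≈0 = ≈-by₁ x-y≈0 1ℤ (identity x y)
    where
    identity : ∀ x y → x ≡ y + 1ℤ * (x - y - 0ℤ)
    identity = solve-∀

  module _ (p-prime : Prime p) where

    euclid : ∀ x y → x * y ≈ 0ℤ → x ≈ 0ℤ ⊎ y ≈ 0ℤ
    euclid x y xy≈0 = Sum.map (λ p∣x → ∣⇒≈0 (∣ᵤ⇒∣ p∣x)) (λ p∣y → ∣⇒≈0 (∣ᵤ⇒∣ p∣y))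
      (euclidsLemma ∣ x ∣ ∣ y ∣ p-prime (subst (p ∣ℕ_) (ℤₚ.abs-* x y) (∣⇒∣ᵤ (≈0⇒∣ xy≈0))))

    *-≉0 : ∀ {x y} → x ≉ 0ℤ → y ≉ 0ℤ → x * y ≉ 0ℤ
    *-≉0 {x} {y} x≉0 y≉0 xy≈0 = [ x≉0 , y≉0 ]′ (euclid x y xy≈0)

    *-cancelˡ : ∀ {x y z} → x ≉ 0ℤ → x * y ≈ x * z → y ≈ z
    *-cancelˡ {x} {y} {z} x≉0 xy≈xz =
      [ (λ x≈0 → contradiction x≈0 x≉0) , difference ]′
        (euclid x (y - z) (≈-by₁ xy≈xz 1ℤ (identity x y z)))
      where
      identity : ∀ x y z → x * (y - z) ≡ 0ℤ + 1ℤ * (x * y - x * z)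
      identity = solve-∀

    small≉0 : ∀ {n} → suc n < p → + suc n ≉ 0ℤ
    small≉0 n<p n≈0 = ℕₚ.<⇒≱ n<p (ℕ∣.∣⇒≤ (∣⇒∣ᵤ (≈0⇒∣ n≈0)))

    1≉0 : 1ℤ ≉ 0ℤ
    1≉0 = small≉0 (ℕ.nonTrivial⇒n>1 p ⦃ prime⇒nonTrivial p-prime ⦄)

    product-≉0 : ∀ {n} (x : Vector ℤ n) → (∀ i → x i ≉ 0ℤ) → product x ≉ 0ℤ
    product-≉0 {zero}  x x≉0 = 1≉0
    product-≉0 {suc n} x x≉0 = *-≉0 (x≉0 zero) (product-≉0 (x ∘ suc) (λ i → x≉0 (suc i)))

    product-≈0 : ∀ {n} (x : Vector ℤ n) → product x ≈ 0ℤ → ∃[ i ] x i ≈ 0ℤ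
    product-≈0 {zero}  x Πx≈0 = contradiction Πx≈0 1≉0
    product-≈0 {suc n} x Πx≈0 =
      [ (λ x₀≈0 → zero , x₀≈0)
      , (λ Πx≈0′ → let i , xᵢ≈0 = product-≈0 (x ∘ suc) Πx≈0′ in suc i , xᵢ≈0)
      ]′ (euclid (x zero) (product (x ∘ suc)) Πx≈0)

    factor-≈0 : ∀ {n} (x : Vector ℤ n) i → x i ≈ 0ℤ → product x ≈ 0ℤ
    factor-≈0 x zero    xᵢ≈0 = *-congʳ (product (x ∘ suc)) xᵢ≈0
    factor-≈0 x (suc i) xᵢ≈0 = ≈-trans (*-congˡ (x zero) (factor-≈0 (x ∘ suc) i xᵢ≈0))
      (≈-reflexive (ℤₚ.*-zeroʳ (x zero)))

    private
      open Exp ℤₚ.+-*-semiring using () renaming (_^_ to _^ᵣ_)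
      open Mult (CommutativeSemiring.+-commutativeMonoid ℤₚ.+-*-commutativeSemiring)
        using () renaming (_×_ to _⨯_)

      ^ᵣ≡^ : ∀ x n → x ^ᵣ n ≡ x ^ n
      ^ᵣ≡^ x zero    = refl
      ^ᵣ≡^ x (suc n) = cong (x *_) (^ᵣ≡^ x n)

      ⨯≡* : ∀ n x → n ⨯ x ≡ + n * x
      ⨯≡* zero    x = refl
      ⨯≡* (suc n) x = trans (cong (λ y → x + y) (⨯≡* n x)) (sym (ℤₚ.suc-* (+ n) x))

    frobenius-mod : ∀ x y → (x + y) ^ p ≈ x ^ p + y ^ p
    frobenius-mod x y = begin
      (x + y) ^ p                   ≡⟨ ^ᵣ≡^ (x + y) p ⟨
      (x + y) ^ᵣ p                  ≡⟨ proj₂ power ⟩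
      x ^ᵣ p + y ^ᵣ p + p ⨯ z       ≡⟨ cong₂ _+_ (cong₂ _+_ (^ᵣ≡^ x p) (^ᵣ≡^ y p)) (⨯≡* p z) ⟩
      x ^ p + y ^ p + + p * z       ≈⟨ +-cong (≈-refl {x ^ p + y ^ p}) (p-multiple z) ⟩
      x ^ p + y ^ p + 0ℤ            ≡⟨ ℤₚ.+-identityʳ (x ^ p + y ^ p) ⟩
      x ^ p + y ^ p                 ∎
      where
      open ≈-Reasoning
      power = frobenius ℤₚ.+-*-commutativeSemiring p-prime x y
      z = proj₁ power

    0^p≡0 : 0ℤ ^ p ≡ 0ℤ
    0^p≡0 = 0^ p ⦃ prime⇒nonZero p-prime ⦄
      where
      0^ : ∀ n ⦃ _ : ℕ.NonZero n ⦄ → 0ℤ ^ n ≡ 0ℤ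
      0^ (suc n) = refl

    fermat-+ : ∀ n → (+ n) ^ p ≈ + n
    fermat-+ zero    = ≈-reflexive 0^p≡0
    fermat-+ (suc n) = begin
      (1ℤ + + n) ^ p      ≈⟨ frobenius-mod 1ℤ (+ n) ⟩
      1ℤ ^ p + (+ n) ^ p  ≈⟨ +-cong (≈-reflexive (ℤₚ.^-zeroˡ p)) (fermat-+ n) ⟩
      1ℤ + + n            ∎
      where open ≈-Reasoning

    -- Induction reaches only the nonnegative integers. For the others, x^p + (-x)^p ≡ (x - x)^p = 0
    -- makes the p-th power odd modulo p, whatever the parity of p.
    fermat : ∀ x → x ^ p ≈ x
    fermat (+ n)    = fermat-+ n
    fermat -[1+ n ] = ≈-by₂ sum≈0 1ℤ (fermat-+ (suc n)) -1ℤ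
      (identity (-[1+ n ] ^ p) ((+ suc n) ^ p) (+ suc n))
      where
      sum≈0 : -[1+ n ] ^ p + (+ suc n) ^ p ≈ 0ℤ
      sum≈0 = ≈-trans (≈-sym (frobenius-mod -[1+ n ] (+ suc n)))
        (≈-reflexive (trans (cong (_^ p) (ℤₚ.+-inverseˡ (+ suc n))) 0^p≡0))
      identity : ∀ y z x → y ≡ - x + 1ℤ * (y + z - 0ℤ) + -1ℤ * (z - x)
      identity = solve-∀

-- The pair `(a , b)` stands for a + b α in ℤ[α] with α² = A α - 1. Pairs with propositional
-- equality allow coordinates to be compared by `cong proj₁`, and a semiring is all that `frobenius`
-- asks for.
quadraticSemiring : ℤ → CommutativeSemiring 0ℓ 0ℓ
quadraticSemiring A = record
  { Carrier = ℤ × ℤ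
  ; _≈_     = _≡_
  ; _+_     = λ (a , b) (c , d) → a + c , b + d
  ; _*_     = λ (a , b) (c , d) → a * c - b * d , a * d + b * c + A * b * d
  ; 0#      = 0ℤ , 0ℤ
  ; 1#      = 1ℤ , 0ℤ
  ; isCommutativeSemiring = isCommutativeSemiringˡ record
    { +-isCommutativeMonoid = record
      { isMonoid = record
        { isSemigroup = record
          { isMagma = record { isEquivalence = isEquivalence ; ∙-cong = cong₂ _ }
          ; assoc   = λ (a , b) (c , d) (e , f) → cong₂ _,_ (ℤₚ.+-assoc a c e) (ℤₚ.+-assoc b d f) }
        ; identity = (λ (a , b) → cong₂ _,_ (ℤₚ.+-identityˡ a) (ℤₚ.+-identityˡ b))
                   , (λ (a , b) → cong₂ _,_ (ℤₚ.+-identityʳ a) (ℤₚ.+-identityʳ b)) }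
      ; comm = λ (a , b) (c , d) → cong₂ _,_ (ℤₚ.+-comm a c) (ℤₚ.+-comm b d) }
    ; *-isCommutativeMonoid = record
      { isMonoid = record
        { isSemigroup = record
          { isMagma = record { isEquivalence = isEquivalence ; ∙-cong = cong₂ _ }
          ; assoc   = λ (a , b) (c , d) (e , f) → cong₂ _,_ (assoc₁ A a b c d e f) (assoc₂ A a b c d e f) }
        ; identity = (λ (a , b) → cong₂ _,_ (identityˡ₁ a b) (identityˡ₂ A a b))
                   , (λ (a , b) → cong₂ _,_ (identityʳ₁ a b) (identityʳ₂ A a b)) }
      ; comm = λ (a , b) (c , d) → cong₂ _,_ (comm₁ a b c d) (comm₂ A a b c d) }
    ; distribʳ = λ (a , b) (c , d) (e , f) → cong₂ _,_ (distrib₁ a b c d e f) (distrib₂ A a b c d e f)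
    ; zeroˡ    = λ (a , b) → cong₂ _,_ (zero₁ a b) (zero₂ A a b) } }
  where
  assoc₁ : ∀ A a b c d e f → (a * c - b * d) * e - (a * d + b * c + A * b * d) * f ≡
    a * (c * e - d * f) - b * (c * f + d * e + A * d * f)
  assoc₁ = solve-∀
  assoc₂ : ∀ A a b c d e f →
    (a * c - b * d) * f + (a * d + b * c + A * b * d) * e + A * (a * d + b * c + A * b * d) * f ≡
    a * (c * f + d * e + A * d * f) + b * (c * e - d * f) + A * b * (c * f + d * e + A * d * f)
  assoc₂ = solve-∀
  identityˡ₁ : ∀ a b → 1ℤ * a - 0ℤ * b ≡ a
  identityˡ₁ = solve-∀
  identityˡ₂ : ∀ A a b → 1ℤ * b + 0ℤ * a + A * 0ℤ * b ≡ b
  identityˡ₂ = solve-∀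
  identityʳ₁ : ∀ a b → a * 1ℤ - b * 0ℤ ≡ a
  identityʳ₁ = solve-∀
  identityʳ₂ : ∀ A a b → a * 0ℤ + b * 1ℤ + A * b * 0ℤ ≡ b
  identityʳ₂ = solve-∀
  comm₁ : ∀ a b c d → a * c - b * d ≡ c * a - d * b
  comm₁ = solve-∀
  comm₂ : ∀ A a b c d → a * d + b * c + A * b * d ≡ c * b + d * a + A * d * b
  comm₂ = solve-∀
  distrib₁ : ∀ a b c d e f → (c + e) * a - (d + f) * b ≡ c * a - d * b + (e * a - f * b)
  distrib₁ = solve-∀
  distrib₂ : ∀ A a b c d e f → (c + e) * b + (d + f) * a + A * (d + f) * b ≡
    c * b + d * a + A * d * b + (e * b + f * a + A * f * b)
  distrib₂ = solve-∀
  zero₁ : ∀ a b → 0ℤ * a - 0ℤ * b ≡ 0ℤ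
  zero₁ = solve-∀
  zero₂ : ∀ A a b → 0ℤ * b + 0ℤ * a + A * 0ℤ * b ≡ 0ℤ
  zero₂ = solve-∀

-- The Lucas sequence at a prime index

module _ (A : ℤ) where

  private
    u : ℕ → ℤ
    u = lucas A 1ℤ

  -- The left side is the norm of α^(n+1) = u (n+1) α - u n, and α has norm 1.
  lucas-norm : ∀ n → u (suc n) * u (suc n) - A * u (suc n) * u n + u n * u n ≡ 1ℤ
  lucas-norm zero    = identity A
    where
    identity : ∀ A → 1ℤ * 1ℤ - A * 1ℤ * 0ℤ + 0ℤ * 0ℤ ≡ 1ℤ
    identity = solve-∀
  lucas-norm (suc n) = trans (identity A (u (suc n)) (u n)) (lucas-norm n)
    where
    identity : ∀ A x y → (A * x - 1ℤ * y) * (A * x - 1ℤ * y) - A * (A * x - 1ℤ * y) * x + x * x ≡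
      x * x - A * x * y + y * y
    identity = solve-∀

  private
    S : CommutativeSemiring 0ℓ 0ℓ
    S = quadraticSemiring A
    open CommutativeSemiring S using (semiring; +-commutativeMonoid)
      renaming (_+_ to _⊞_; _*_ to _⊠_)
    open Exp semiring using () renaming (_^_ to _^^_)
    open Mult +-commutativeMonoid using () renaming (_×_ to _⨯_)

    root-^ : ∀ n → (0ℤ , 1ℤ) ^^ suc n ≡ (- u n , u (suc n))
    root-^ zero    = cong₂ _,_ refl (identity A)
      where
      identity : ∀ A → 0ℤ * 0ℤ + 1ℤ * 1ℤ + A * 1ℤ * 0ℤ ≡ 1ℤ
      identity = solve-∀
    root-^ (suc n) = trans (cong ((0ℤ , 1ℤ) ⊠_) (root-^ n))
      (cong₂ _,_ (identity₁ (u n) (u (suc n))) (identity₂ A (u n) (u (suc n))))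
      where
      identity₁ : ∀ x y → 0ℤ * - x - 1ℤ * y ≡ - y
      identity₁ = solve-∀
      identity₂ : ∀ A x y → 0ℤ * y + 1ℤ * - x + A * 1ℤ * y ≡ A * y - 1ℤ * x
      identity₂ = solve-∀

    -- `(A , -1ℤ)` is A - α, which is both the conjugate and the inverse of α.
    conjugate-^ : ∀ n → (A , -1ℤ) ^^ suc n ≡ (u (suc (suc n)) , - u (suc n))
    conjugate-^ zero    = cong₂ _,_ (identity₁ A) (identity₂ A)
      where
      identity₁ : ∀ A → A * 1ℤ - -1ℤ * 0ℤ ≡ A * 1ℤ - 1ℤ * 0ℤ
      identity₁ = solve-∀
      identity₂ : ∀ A → A * 0ℤ + -1ℤ * 1ℤ + A * -1ℤ * 0ℤ ≡ -1ℤ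
      identity₂ = solve-∀
    conjugate-^ (suc n) = trans (cong ((A , -1ℤ) ⊠_) (conjugate-^ n))
      (cong₂ _,_ (identity₁ A (u (suc n)) (u (suc (suc n)))) (identity₂ A (u (suc n)) (u (suc (suc n)))))
      where
      identity₁ : ∀ A x y → A * y - -1ℤ * - x ≡ A * y - 1ℤ * x
      identity₁ = solve-∀
      identity₂ : ∀ A x y → A * - x + -1ℤ * y + A * -1ℤ * - x ≡ - y
      identity₂ = solve-∀

    scalar-^ : ∀ n → (A , 0ℤ) ^^ n ≡ (A ^ n , 0ℤ)
    scalar-^ zero    = refl
    scalar-^ (suc n) = trans (cong ((A , 0ℤ) ⊠_) (scalar-^ n))
      (cong₂ _,_ (identity₁ A (A ^ n)) (identity₂ A (A ^ n)))
      where
      identity₁ : ∀ A x → A * x - 0ℤ * 0ℤ ≡ A * x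
      identity₁ = solve-∀
      identity₂ : ∀ A x → A * 0ℤ + 0ℤ * x + A * 0ℤ * 0ℤ ≡ 0ℤ
      identity₂ = solve-∀

    multiple-proj₁ : ∀ n x → proj₁ (n ⨯ x) ≡ + n * proj₁ x
    multiple-proj₁ zero    x = refl
    multiple-proj₁ (suc n) x =
      trans (cong (λ y → proj₁ x + y) (multiple-proj₁ n x)) (sym (ℤₚ.suc-* (+ n) (proj₁ x)))

  module _ {n : ℕ} (p-prime : Prime (suc n)) where
    open Modular (suc n)

    -- Frobenius applied to α + (A - α) = A: the p-th powers of α and of its conjugate add up to
    -- A^p, hence to A, modulo p. The congruence is the first coordinate of this.
    lucas-trace : u (suc (suc n)) - u n ≈ A
    lucas-trace = begin
      u (suc (suc n)) - u n                                 ≡⟨ identity (u (suc (suc n))) (u n) ⟩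
      - u n + u (suc (suc n)) + 0ℤ                          ≈⟨ +-cong (≈-refl { - u n + u (suc (suc n))}) (p-multiple (proj₁ z)) ⟨
      - u n + u (suc (suc n)) + + suc n * proj₁ z           ≡⟨ trace ⟨
      A ^ suc n                                             ≈⟨ fermat p-prime A ⟩
      A                                                     ∎
      where
      open ≈-Reasoning
      power = frobenius S p-prime (0ℤ , 1ℤ) (A , -1ℤ)
      z = proj₁ power
      identity : ∀ x y → x - y ≡ - y + x + 0ℤ
      identity = solve-∀
      trace : A ^ suc n ≡ - u n + u (suc (suc n)) + + suc n * proj₁ z
      trace = trans
        (cong proj₁ (trans (sym (scalar-^ (suc n)))
          (trans (cong (λ x → (x , 0ℤ) ^^ suc n) (sym (ℤₚ.+-identityˡ A))) (proj₂ power))))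
        (cong₂ _+_ (cong₂ _+_ (cong proj₁ (root-^ n)) (cong proj₁ (conjugate-^ n))) (multiple-proj₁ (suc n) z))

    -- With x = u p and y = u (p - 1), the trace gives 2 y = A (x - 1), which
    -- turns four times the norm equation into (x - 1) (x + 1) (4 - A²) = 0.
    lucas-p≈±1 : + 2 ≉ 0ℤ → + 4 - A * A ≉ 0ℤ →
      (u (suc n) ≈ 1ℤ × u n ≈ 0ℤ) ⊎ (u (suc n) ≈ -1ℤ × u n ≈ - A)
    lucas-p≈±1 2≉0 4-A²≉0 =
      [ (λ ≈0 → [ (λ 4-A²≈0 → contradiction 4-A²≈0 4-A²≉0) , plus ]′
                  (euclid p-prime (+ 4 - A * A) (x - 1ℤ) ≈0))
      , minus
      ]′ (euclid p-prime ((+ 4 - A * A) * (x - 1ℤ)) (x + 1ℤ)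
           (≈-by₂ lucas-trace (+ 2 * y - A * (x + 1ℤ)) (≈-reflexive (lucas-norm n)) (+ 4) (factored A x y)))
      where
      x = u (suc n)
      y = u n
      factored : ∀ A x y → (+ 4 - A * A) * (x - 1ℤ) * (x + 1ℤ) ≡
        0ℤ + (+ 2 * y - A * (x + 1ℤ)) * (A * x - 1ℤ * y - y - A)
          + + 4 * (x * x - A * x * y + y * y - 1ℤ)
      factored = solve-∀
      plus-identity : ∀ A x y →
        + 2 * y ≡ + 2 * 0ℤ + A * (x - 1ℤ - 0ℤ) + -1ℤ * (A * x - 1ℤ * y - y - A)
      plus-identity = solve-∀
      minus-identity : ∀ A x y →
        + 2 * y ≡ + 2 * - A + A * (x + 1ℤ - 0ℤ) + -1ℤ * (A * x - 1ℤ * y - y - A)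
      minus-identity = solve-∀
      plus : x - 1ℤ ≈ 0ℤ → (x ≈ 1ℤ × y ≈ 0ℤ) ⊎ (x ≈ -1ℤ × y ≈ - A)
      plus x-1≈0 = inj₁ (difference x-1≈0
        , *-cancelˡ p-prime 2≉0 (≈-by₂ x-1≈0 A lucas-trace -1ℤ (plus-identity A x y)))
      minus : x + 1ℤ ≈ 0ℤ → (x ≈ 1ℤ × y ≈ 0ℤ) ⊎ (x ≈ -1ℤ × y ≈ - A)
      minus x+1≈0 = inj₂ (difference x+1≈0
        , *-cancelˡ p-prime 2≉0 (≈-by₂ x+1≈0 A lucas-trace -1ℤ (minus-identity A x y)))

-- Polynomials with recurrent coefficients

evaluate : (ℕ → ℤ) → ℕ → ℤ → ℤ
evaluate y n t = sum {n} (λ k → y (toℕ k) * t ^ toℕ k)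

evaluate-suc : ∀ y n t → evaluate y (suc n) t ≡ y 0 + t * evaluate (y ∘ suc) n t
evaluate-suc y n t = cong₂ _+_ (ℤₚ.*-identityʳ (y 0)) (trans
  (sum-cong-≗ {n} (λ k → shift (y (suc (toℕ k))) t (t ^ toℕ k)))
  (sym (*-distribˡ-sum {n} t (λ k → y (suc (toℕ k)) * t ^ toℕ k))))
  where
  shift : ∀ y t x → y * (t * x) ≡ t * (y * x)
  shift = solve-∀

evaluate-last : ∀ y n t → evaluate y (suc n) t ≡ evaluate y n t + y n * t ^ n
evaluate-last y zero    t = ℤₚ.+-comm (y 0 * 1ℤ) 0ℤ
evaluate-last y (suc n) t = begin
  evaluate y (suc (suc n)) t
    ≡⟨ evaluate-suc y (suc n) t ⟩
  y 0 + t * evaluate (y ∘ suc) (suc n) t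
    ≡⟨ cong (λ x → y 0 + t * x) (evaluate-last (y ∘ suc) n t) ⟩
  y 0 + t * (evaluate (y ∘ suc) n t + y (suc n) * t ^ n)
    ≡⟨ identity (y 0) t (evaluate (y ∘ suc) n t) (y (suc n)) (t ^ n) ⟩
  y 0 + t * evaluate (y ∘ suc) n t + y (suc n) * t ^ suc n
    ≡⟨ cong (_+ y (suc n) * t ^ suc n) (evaluate-suc y n t) ⟨
  evaluate y (suc n) t + y (suc n) * t ^ suc n ∎
  where
  open ≡-Reasoning
  identity : ∀ a t e b x → a + t * (e + b * x) ≡ a + t * e + b * (t * x)
  identity = solve-∀

evaluate-scale : ∀ a y n t → evaluate (λ k → a * y k) n t ≡ a * evaluate y n t
evaluate-scale a y n t = trans
  (sum-cong-≗ {n} (λ k → ℤₚ.*-assoc a (y (toℕ k)) (t ^ toℕ k)))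
  (sym (*-distribˡ-sum {n} a (λ k → y (toℕ k) * t ^ toℕ k)))

evaluate-geometric : ∀ n t → (t - 1ℤ) * evaluate (λ _ → 1ℤ) n t ≡ t ^ n - 1ℤ
evaluate-geometric zero    t = ℤₚ.*-zeroʳ (t - 1ℤ)
evaluate-geometric (suc n) t = begin
  (t - 1ℤ) * evaluate (λ _ → 1ℤ) (suc n) t               ≡⟨ cong ((t - 1ℤ) *_) (evaluate-suc (λ _ → 1ℤ) n t) ⟩
  (t - 1ℤ) * (1ℤ + t * evaluate (λ _ → 1ℤ) n t)          ≡⟨ regroup t (evaluate (λ _ → 1ℤ) n t) ⟩
  t - 1ℤ + t * ((t - 1ℤ) * evaluate (λ _ → 1ℤ) n t)      ≡⟨ cong (λ x → t - 1ℤ + t * x) (evaluate-geometric n t) ⟩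
  t - 1ℤ + t * (t ^ n - 1ℤ)                              ≡⟨ collect t (t ^ n) ⟩
  t ^ suc n - 1ℤ                                         ∎
  where
  open ≡-Reasoning
  regroup : ∀ t e → (t - 1ℤ) * (1ℤ + t * e) ≡ t - 1ℤ + t * ((t - 1ℤ) * e)
  regroup = solve-∀
  collect : ∀ t x → t - 1ℤ + t * (x - 1ℤ) ≡ t * x - 1ℤ
  collect = solve-∀

charPoly : ℤ → ℤ → ℤ
charPoly A t = t * t - A * t + 1ℤ

-- The reversed characteristic polynomial of the recurrence equals the
-- polynomial itself, so multiplying by it telescopes.
charPoly-evaluate : ∀ A y z → (∀ k → y (suc (suc k)) ≡ A * y (suc k) - y k + z k) → ∀ n t →
  charPoly A t * evaluate y n t ≡
  y 0 + (y 1 - A * y 0) * t - y n * t ^ n - (y (suc n) - A * y n) * (t * t ^ n)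
    + t * t * evaluate z n t
charPoly-evaluate A y z recurrence zero t = identity A t (y 0) (y 1)
  where
  identity : ∀ A t a b → (t * t - A * t + 1ℤ) * 0ℤ ≡
    a + (b - A * a) * t - a * 1ℤ - (b - A * a) * (t * 1ℤ) + t * t * 0ℤ
  identity = solve-∀
charPoly-evaluate A y z recurrence (suc n) t = begin
  charPoly A t * evaluate y (suc n) t
    ≡⟨ cong (charPoly A t *_) (evaluate-last y n t) ⟩
  charPoly A t * (evaluate y n t + y n * t ^ n)
    ≡⟨ ℤₚ.*-distribˡ-+ (charPoly A t) (evaluate y n t) (y n * t ^ n) ⟩
  charPoly A t * evaluate y n t + charPoly A t * (y n * t ^ n)
    ≡⟨ cong (_+ charPoly A t * (y n * t ^ n)) (charPoly-evaluate A y z recurrence n t) ⟩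
  y 0 + (y 1 - A * y 0) * t - y n * t ^ n - (y (suc n) - A * y n) * (t * t ^ n)
    + t * t * evaluate z n t + charPoly A t * (y n * t ^ n)
    ≡⟨ step A t (y 0) (y 1) (y n) (y (suc n)) (t ^ n) (evaluate z n t) (z n) ⟩
  y 0 + (y 1 - A * y 0) * t - y (suc n) * t ^ suc n
    - (A * y (suc n) - y n + z n - A * y (suc n)) * (t * t ^ suc n)
    + t * t * (evaluate z n t + z n * t ^ n)
    ≡⟨ cong₂ (λ a b → y 0 + (y 1 - A * y 0) * t - y (suc n) * t ^ suc n
         - (a - A * y (suc n)) * (t * t ^ suc n) + t * t * b)
         (recurrence n) (evaluate-last z n t) ⟨
  y 0 + (y 1 - A * y 0) * t - y (suc n) * t ^ suc n
    - (y (suc (suc n)) - A * y (suc n)) * (t * t ^ suc n) + t * t * evaluate z (suc n) t ∎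
  where
  open ≡-Reasoning
  step : ∀ A t a b c d x e f →
    a + (b - A * a) * t - c * x - (d - A * c) * (t * x) + t * t * e + (t * t - A * t + 1ℤ) * (c * x) ≡
    a + (b - A * a) * t - d * (t * x) - (A * d - c + f - A * d) * (t * (t * x)) + t * t * (e + f * x)
  step = solve-∀

^-distrib-* : ∀ x y n → (x * y) ^ n ≡ x ^ n * y ^ n
^-distrib-* x y zero    = refl
^-distrib-* x y (suc n) = trans (cong (x * y *_) (^-distrib-* x y n)) (identity x y (x ^ n) (y ^ n))
  where
  identity : ∀ x y a b → x * y * (a * b) ≡ x * a * (y * b)
  identity = solve-∀

-- Factorization of the matrix by powers of the nonzero residues

module PrimeModulus {m : ℕ} (p-prime : Prime (suc (suc m))) where
  open Modular (suc (suc m))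

  n p : ℕ
  n = suc m
  p = suc n

  fermat⁻ : ∀ {x} → x ≉ 0ℤ → x ^ n ≈ 1ℤ
  fermat⁻ {x} x≉0 = *-cancelˡ p-prime x≉0
    (≈-trans (fermat p-prime x) (≈-reflexive (sym (ℤₚ.*-identityʳ x))))

  ^-≉0 : ∀ {x} k → x ≉ 0ℤ → x ^ k ≉ 0ℤ
  ^-≉0 zero    x≉0 = 1≉0 p-prime
  ^-≉0 (suc k) x≉0 = *-≉0 p-prime x≉0 (^-≉0 k x≉0)

  point : Fin n → ℤ
  point i = + suc (toℕ i)

  point≉0 : ∀ i → point i ≉ 0ℤ
  point≉0 i = small≉0 p-prime (ℕ.s≤s (toℕ<n i))

  inverse : Fin n → ℤ
  inverse i = point i ^ m

  inverseʳ : ∀ i → point i * inverse i ≈ 1ℤ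
  inverseʳ i = fermat⁻ (point≉0 i)

  point-injective : ∀ i j → point i ≈ point j → i ≡ j
  point-injective i j (congruence p∣i-j) = toℕ-injective (ℕₚ.suc-injective (ℤₚ.+-injective
    (ℤₚ.i-j≡0⇒i≡j (point i) (point j) (ℤₚ.∣i∣≡0⇒i≡0 (multiple-zero _ bound (∣⇒∣ᵤ p∣i-j))))))
    where
    multiple-zero : ∀ a → a < p → p ∣ℕ a → a ≡ 0
    multiple-zero zero    a<p p∣a = refl
    multiple-zero (suc a) a<p p∣a = contradiction p∣a (ℕ∣.>⇒∤ a<p)
    bound : ∣ point i - point j ∣ < p
    bound = ℕ.s≤s (ℕₚ.≤-trans
      (subst (λ x → ∣ x ∣ ≤ suc (toℕ i) ℕ.⊔ suc (toℕ j)) (sym (ℤₚ.m-n≡m⊖n (suc (toℕ i)) (suc (toℕ j))))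
        (ℤₚ.∣m⊝n∣≤m⊔n (suc (toℕ i)) (suc (toℕ j))))
      (ℕₚ.⊔-lub (toℕ<n i) (toℕ<n j)))

  ratio : Fin n → Fin n → ℤ
  ratio i j = point i * inverse j

  ratio≉0 : ∀ i j → ratio i j ≉ 0ℤ
  ratio≉0 i j = *-≉0 p-prime (point≉0 i) λ inverse≈0 →
    1≉0 p-prime (≈-trans (≈-sym (inverseʳ j))
      (≈-trans (*-congˡ (point j) inverse≈0) (≈-reflexive (ℤₚ.*-zeroʳ (point j)))))

  V W : Matrix n
  V i k = point i ^ toℕ k
  W k j = inverse j ^ toℕ k

  sum-V-W : ∀ (y : ℕ → ℤ) i j →
    (V ⊗ λ k j → y (toℕ k) * W k j) i j ≡ evaluate y n (ratio i j)
  sum-V-W y i j = sum-cong-≗ {n} λ k → trans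
    (regroup (point i ^ toℕ k) (y (toℕ k)) (inverse j ^ toℕ k))
    (cong (y (toℕ k) *_) (sym (^-distrib-* (point i) (inverse j) (toℕ k))))
    where
    regroup : ∀ a y b → a * (y * b) ≡ y * (a * b)
    regroup = solve-∀

  -- The entry is a geometric sum in t = i / j. For t ≡ 1 it is p - 1 ≡ -1; otherwise t - 1 times it
  -- is t^(p-1) - 1 ≡ 0, and t - 1 can be cancelled.
  V⊗W : ∀ i j → (V ⊗ W) i j ≈ diagonal (λ _ → -1ℤ) i j
  V⊗W i j = ≈-trans
    (≈-reflexive (trans (sum-cong-≗ {n} (λ k → cong (V i k *_) (sym (ℤₚ.*-identityˡ (W k j)))))
      (sum-V-W (λ _ → 1ℤ) i j)))
    orthogonal
    where
    ones : ∀ l t → t ≈ 1ℤ → evaluate (λ _ → 1ℤ) l t ≈ + l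
    ones zero    t t≈1 = ≈-refl
    ones (suc l) t t≈1 = ≈-trans (≈-reflexive (evaluate-suc (λ _ → 1ℤ) l t))
      (+-cong (≈-refl {1ℤ}) (≈-trans (*-cong t≈1 (ones l t t≈1)) (≈-reflexive (ℤₚ.*-identityˡ (+ l)))))
    n≈-1 : + n ≈ -1ℤ
    n≈-1 = ≈-by₁ p≈0 1ℤ (identity (+ n))
      where
      identity : ∀ x → x ≡ -1ℤ + 1ℤ * (1ℤ + x - 0ℤ)
      identity = solve-∀
    δ-off : ∀ {l} (i j : Fin l) → i ≢ j → δ i j ≡ 0ℤ
    δ-off zero    zero    i≢j = contradiction refl i≢j
    δ-off zero    (suc j) i≢j = refl
    δ-off (suc i) zero    i≢j = refl
    δ-off (suc i) (suc j) i≢j = δ-off i j (λ i≡j → i≢j (cong suc i≡j))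
    orthogonal : evaluate (λ _ → 1ℤ) n (ratio i j) ≈ -1ℤ * δ i j
    orthogonal with i Fin.≟ j
    ... | yes refl = ≈-trans (ones n _ (inverseʳ i)) (≈-trans n≈-1
            (≈-reflexive (cong (-1ℤ *_) (sym (δ-refl i)))))
    ... | no i≢j = [ (λ ratio≈1 → contradiction (point-injective i j (equal ratio≈1)) i≢j)
            , (λ ≈0 → ≈-trans ≈0 (≈-reflexive (cong (-1ℤ *_) (sym (δ-off i j i≢j)))))
            ]′ (euclid p-prime (ratio i j - 1ℤ) (evaluate (λ _ → 1ℤ) n (ratio i j))
              (≈-trans (≈-reflexive (evaluate-geometric n (ratio i j)))
                (≈-by₁ (fermat⁻ (ratio≉0 i j)) 1ℤ (identity (ratio i j ^ n)))))
      where
      identity : ∀ x → x - 1ℤ ≡ 0ℤ + 1ℤ * (x - 1ℤ)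
      identity = solve-∀
      identity′ : ∀ i j j′ → i ≡ j + j * (i * j′ - 1ℤ) + - i * (j * j′ - 1ℤ)
      identity′ = solve-∀
      equal : ratio i j - 1ℤ ≈ 0ℤ → point i ≈ point j
      equal ratio≈1 = ≈-by₂ (difference {ratio i j} {1ℤ} ratio≈1) (point j) (inverseʳ j) (- point i)
        (identity′ (point i) (point j) (inverse j))

  det-V⊗W≉0 : det n V * det n W ≉ 0ℤ
  det-V⊗W≉0 ≈0 = product-≉0 p-prime {n} (λ _ → -1ℤ)
    (λ _ -1≈0 → 1≉0 p-prime (≈-by₁ -1≈0 -1ℤ refl))
    (≈-trans (≈-reflexive (sym (det-diagonal n (λ _ → -1ℤ))))
      (≈-trans (≈-sym (det-cong-mod n V⊗W))
        (≈-trans (≈-reflexive (det-⊗ n V W)) ≈0)))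

  det-V≉0 : det n V ≉ 0ℤ
  det-V≉0 ≈0 = det-V⊗W≉0 (*-congʳ (det n W) ≈0)

  det-W≉0 : det n W ≉ 0ℤ
  det-W≉0 ≈0 = det-V⊗W≉0 (≈-trans (*-congˡ (det n V) ≈0) (≈-reflexive (ℤₚ.*-zeroʳ (det n V))))

  -- Replacing column 0 of the identity by the coefficients y gives a matrix
  -- of determinant y 0, whose product with V has zero column 0.
  vanishing-polynomial : ∀ (y : ℕ → ℤ) → (∀ {t} → t ≉ 0ℤ → evaluate y n t ≈ 0ℤ) → y 0 ≈ 0ℤ
  vanishing-polynomial y vanishes = [ (λ V≈0 → contradiction V≈0 det-V≉0) , (λ y₀≈0 → y₀≈0) ]′
    (euclid p-prime (det n V) (y 0) (≈-trans
      (≈-reflexive (sym (trans (det-⊗ n V M) (cong (det n V *_) det-M))))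
      (det-zero-column m (V ⊗ M) (λ i → ≈-trans
        (≈-reflexive (sum-cong-≗ {n} (λ k → ℤₚ.*-comm (V i k) (y (toℕ k)))))
        (vanishes (point≉0 i))))))
    where
    M : Matrix n
    M k zero    = y (toℕ k)
    M k (suc j) = δ k (suc j)
    det-M : det n M ≡ y 0
    det-M = trans (det-head-row m M (λ _ → refl))
      (trans (cong (y 0 *_) (det-δ m)) (ℤₚ.*-identityʳ (y 0)))

  module _ (c μ : ℤ) (μ≉0 : μ ≉ 0ℤ) (w : ℕ → ℤ)
    (w-interpolates : ∀ {t} → t ≉ 0ℤ → μ * (t * t + c * t + 1ℤ) ^ m ≈ evaluate w n t) where

    -- The quadratic form is j² Q(i / j). Hence the exponent p - 2 = `m` leaves a function of the
    -- ratio alone, times a factor that depends only on the column.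
    D-factorization : ∀ i j → μ * D p c i j ≈
      (V ⊗ (λ k j → w (toℕ k) * W k j)) i j * (point j * point j) ^ m
    D-factorization i j = begin
      μ * D p c i j
        ≈⟨ *-congˡ μ (^-cong m homogenize) ⟩
      μ * (q * (point j * point j)) ^ m
        ≡⟨ cong (μ *_) (^-distrib-* q (point j * point j) m) ⟩
      μ * (q ^ m * (point j * point j) ^ m)
        ≡⟨ ℤₚ.*-assoc μ (q ^ m) ((point j * point j) ^ m) ⟨
      μ * q ^ m * (point j * point j) ^ m
        ≈⟨ *-congʳ ((point j * point j) ^ m) (w-interpolates (ratio≉0 i j)) ⟩
      evaluate w n (ratio i j) * (point j * point j) ^ m
        ≡⟨ cong (_* (point j * point j) ^ m) (sum-V-W w i j) ⟨
      (V ⊗ (λ k j → w (toℕ k) * W k j)) i j * (point j * point j) ^ m ∎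
      where
      open ≈-Reasoning
      q = ratio i j * ratio i j + c * ratio i j + 1ℤ
      homogenize : point i ^ 2 + c * point i * point j + point j ^ 2 ≈ q * (point j * point j)
      homogenize = ≈-by₁ (inverseʳ j)
        (- (point i * point i * (point j * inverse j + 1ℤ)) - c * point i * point j)
        (identity c (point i) (point j) (inverse j))
        where
        identity : ∀ c i j j′ → i * (i * 1ℤ) + c * i * j + j * (j * 1ℤ) ≡
          (i * j′ * (i * j′) + c * (i * j′) + 1ℤ) * (j * j)
            + (- (i * i * (j * j′ + 1ℤ)) - c * i * j) * (j * j′ - 1ℤ)
        identity = solve-∀

    w-product scales : ℤ
    w-product = product {n} (λ k → w (toℕ k))
    scales    = product {n} (λ j → (point j * point j) ^ m)

    det-D-factorization : product {n} (λ _ → μ) * det n (D p c) ≈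
      det n V * (w-product * det n W) * scales
    det-D-factorization = begin
      product {n} (λ _ → μ) * det n (D p c)
        ≡⟨ det-scale-rows n (λ _ → μ) (D p c) ⟨
      det n (λ i j → μ * D p c i j)
        ≈⟨ det-cong-mod n D-factorization ⟩
      det n (λ i j → (V ⊗ U) i j * (point j * point j) ^ m)
        ≡⟨ det-scale-columns n (λ j → (point j * point j) ^ m) (V ⊗ U) ⟩
      det n (V ⊗ U) * scales
        ≡⟨ cong (_* scales)
             (trans (det-⊗ n V U) (cong (det n V *_) (det-scale-rows n (λ k → w (toℕ k)) W))) ⟩
      det n V * (w-product * det n W) * scales ∎
      where
      open ≈-Reasoning
      U : Matrix n
      U k j = w (toℕ k) * W k j

    det-D≈0⇒ : det n (D p c) ≈ 0ℤ → ∃[ k ] w (toℕ {n} k) ≈ 0ℤ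
    det-D≈0⇒ D≈0 =
      [ [ (λ V≈0 → contradiction V≈0 det-V≉0)
        , (λ wW≈0 → [ product-≈0 p-prime {n} (λ k → w (toℕ k)) , (λ W≈0 → contradiction W≈0 det-W≉0) ]′
            (euclid p-prime w-product (det n W) wW≈0))
        ]′ ∘ euclid p-prime (det n V) (w-product * det n W)
      , (λ scales≈0 → contradiction scales≈0
          (product-≉0 p-prime _ (λ j → ^-≉0 m (*-≉0 p-prime (point≉0 j) (point≉0 j)))))
      ]′ (euclid p-prime (det n V * (w-product * det n W)) scales
           (≈-trans (≈-sym det-D-factorization)
             (≈-trans (*-congˡ (product {n} (λ _ → μ)) D≈0) (≈-reflexive (ℤₚ.*-zeroʳ (product {n} (λ _ → μ)))))))

    det-D≈0⇐ : ∃[ k ] w (toℕ {n} k) ≈ 0ℤ → det n (D p c) ≈ 0ℤ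
    det-D≈0⇐ (k , wₖ≈0) =
      [ (λ μ≈0 → contradiction μ≈0 (product-≉0 p-prime {n} _ (λ _ → μ≉0))) , (λ D≈0 → D≈0) ]′
        (euclid p-prime (product {n} (λ _ → μ)) (det n (D p c))
          (≈-trans det-D-factorization (*-congʳ scales
            (≈-trans (*-congˡ (det n V) (*-congʳ (det n W) (factor-≈0 p-prime {n} (λ k → w (toℕ k)) k wₖ≈0)))
              (≈-reflexive (ℤₚ.*-zeroʳ (det n V)))))))

-- With μ = 4 - A² and α + 1/α = A, `wNonresidue A k` is -(α^(k+2) + α^-(k+2)), and `wResidue A k`
-- is α^(k+2) + α^-(k+2) + (k + 2) μ u (k+1). Rewritten in terms of u k and u (k+1), they are the
-- expressions of the theorem for A = - c.
wResidue wNonresidue : ℤ → ℕ → ℤ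
wResidue    A k = - A * lucas A 1ℤ k + (+ k * (+ 4 - A * A) + + 6 - A * A) * lucas A 1ℤ (suc k)
wNonresidue A k = A * lucas A 1ℤ k + (+ 2 - A * A) * lucas A 1ℤ (suc k)

-- Interpolation of the power of Q in the two cases

module Interpolation {m : ℕ} (p-prime : Prime (suc (suc m))) (A : ℤ) where
  open Modular (suc (suc m))
  open PrimeModulus p-prime

  private
    u : ℕ → ℤ
    u = lucas A 1ℤ
    Q : ℤ → ℤ
    Q = charPoly A
    μ : ℤ
    μ = + 4 - A * A

  discriminant : ∀ t → Q t ≈ 0ℤ → (+ 2 * t - A) * (+ 2 * t - A) ≈ A * A - + 4
  discriminant t Q≈0 = ≈-by₁ Q≈0 (+ 4) (identity A t)
    where
    identity : ∀ A t → (+ 2 * t - A) * (+ 2 * t - A) ≡ A * A - + 4 + + 4 * (t * t - A * t + 1ℤ - 0ℤ)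
    identity = solve-∀

  invert-Q : ∀ t {e} → Q t ≉ 0ℤ → Q t * e ≈ μ → μ * Q t ^ m ≈ e
  invert-Q t {e} Q≉0 Qe≈μ = begin
    μ * Q t ^ m            ≈⟨ *-congʳ (Q t ^ m) Qe≈μ ⟨
    Q t * e * Q t ^ m      ≡⟨ regroup (Q t) e (Q t ^ m) ⟩
    Q t ^ n * e            ≈⟨ *-congʳ e (fermat⁻ Q≉0) ⟩
    1ℤ * e                 ≡⟨ ℤₚ.*-identityˡ e ⟩
    e                      ∎
    where
    open ≈-Reasoning
    regroup : ∀ q e x → q * e * x ≡ q * x * e
    regroup = solve-∀

  -- Since t^(p-1) ≡ 1, the boundary terms at both ends of the telescoping sum merge. What is left
  -- of them measures how far `y` is from having period p - 1.
  Q-evaluate : ∀ y z → (∀ k → y (suc (suc k)) ≡ A * y (suc k) - y k + z k) → ∀ {t} → t ≉ 0ℤ →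
    Q t * evaluate y n t ≈
    (y 0 - y n) + (y 1 - A * y 0 - (y (suc n) - A * y n)) * t + t * t * evaluate z n t
  Q-evaluate y z recurrence {t} t≉0 = ≈-trans
    (≈-reflexive (charPoly-evaluate A y z recurrence n t))
    (≈-by₁ (fermat⁻ t≉0) (- y n - (y (suc n) - A * y n) * t)
      (identity A t (y 0) (y 1) (y n) (y (suc n)) (t ^ n) (evaluate z n t)))
    where
    identity : ∀ A t a b c d x e →
      a + (b - A * a) * t - c * x - (d - A * c) * (t * x) + t * t * e ≡
      (a - c) + (b - A * a - (d - A * c)) * t + t * t * e + (- c - (d - A * c) * t) * (x - 1ℤ)
    identity = solve-∀

  Q-evaluate-homogeneous : ∀ y → (∀ k → y (suc (suc k)) ≡ A * y (suc k) - y k) → ∀ {t} → t ≉ 0ℤ →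
    Q t * evaluate y n t ≈ (y 0 - y n) + (y 1 - A * y 0 - (y (suc n) - A * y n)) * t
  Q-evaluate-homogeneous y recurrence {t} t≉0 = ≈-trans
    (Q-evaluate y (λ _ → 0ℤ) (λ k → trans (recurrence k) (sym (ℤₚ.+-identityʳ _))) t≉0)
    (≈-reflexive (trans (cong (λ e → r + t * t * e) (sum-zero {n} _ (λ k → ℤₚ.*-zeroˡ (t ^ toℕ k))))
      (drop r t)))
    where
    r = (y 0 - y n) + (y 1 - A * y 0 - (y (suc n) - A * y n)) * t
    drop : ∀ r t → r + t * t * 0ℤ ≡ r
    drop = solve-∀

  module Nonresidue (2≉0 : + 2 ≉ 0ℤ) (μ≉0 : μ ≉ 0ℤ)
    (nonresidue : ∀ x → ¬ (x * x ≈ A * A - + 4)) where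

    Q≉0 : ∀ t → Q t ≉ 0ℤ
    Q≉0 t Q≈0 = nonresidue (+ 2 * t - A) (discriminant t Q≈0)

    lucas-values : u p ≈ -1ℤ × u n ≈ - A
    -- The polynomial with coefficients `u (suc k)` would vanish everywhere, but its constant
    -- coefficient `u 1` is 1.
    lucas-values = [ (λ (uₚ≈1 , uₙ≈0) → contradiction
                         (vanishing-polynomial (λ k → u (suc k)) (vanishes uₚ≈1 uₙ≈0)) (1≉0 p-prime))
                   , (λ values → values)
                   ]′ (lucas-p≈±1 A p-prime 2≉0 μ≉0)
      where
      identity : ∀ A x y t →
        (1ℤ - x) + (A * 1ℤ - 1ℤ * 0ℤ - A * 1ℤ - (A * x - 1ℤ * y - A * x)) * t ≡
        0ℤ + -1ℤ * (x - 1ℤ) + t * (y - 0ℤ)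
      identity = solve-∀
      recurrence : ∀ k → u (suc (suc (suc k))) ≡ A * u (suc (suc k)) - u (suc k)
      recurrence k = cong (λ x → A * u (suc (suc k)) - x) (ℤₚ.*-identityˡ (u (suc k)))
      vanishes : u p ≈ 1ℤ → u n ≈ 0ℤ → ∀ {t} → t ≉ 0ℤ → evaluate (λ k → u (suc k)) n t ≈ 0ℤ
      vanishes uₚ≈1 uₙ≈0 {t} t≉0 =
        [ (λ Q≈0 → contradiction Q≈0 (Q≉0 t)) , (λ ≈0 → ≈0) ]′
          (euclid p-prime (Q t) (evaluate (λ k → u (suc k)) n t) (≈-trans
            (Q-evaluate-homogeneous (λ k → u (suc k)) recurrence t≉0)
            (≈-by₂ uₚ≈1 -1ℤ uₙ≈0 t (identity A (u p) (u n) t))))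

    interpolates : ∀ {t} → t ≉ 0ℤ → μ * Q t ^ m ≈ evaluate (wNonresidue A) n t
    interpolates {t} t≉0 = invert-Q t (Q≉0 t) (≈-trans
      (Q-evaluate-homogeneous (wNonresidue A) recurrence t≉0)
      (≈-by₂ (proj₁ lucas-values) (- (+ 2 - A * A) - A * t) (proj₂ lucas-values) (- A + + 2 * t)
        (identity A (u p) (u n) t)))
      where
      recurrence : ∀ k → wNonresidue A (suc (suc k)) ≡ A * wNonresidue A (suc k) - wNonresidue A k
      recurrence k = step A (u (suc k)) (u k)
        where
        step : ∀ A x y →
          A * (A * x - 1ℤ * y) + (+ 2 - A * A) * (A * (A * x - 1ℤ * y) - 1ℤ * x) ≡
          A * (A * x + (+ 2 - A * A) * (A * x - 1ℤ * y)) - (A * y + (+ 2 - A * A) * x)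
        step = solve-∀
      identity : ∀ A x y t →
        (A * 0ℤ + (+ 2 - A * A) * 1ℤ - (A * y + (+ 2 - A * A) * x))
        + (A * 1ℤ + (+ 2 - A * A) * (A * 1ℤ - 1ℤ * 0ℤ) - A * (A * 0ℤ + (+ 2 - A * A) * 1ℤ)
            - (A * x + (+ 2 - A * A) * (A * x - 1ℤ * y) - A * (A * y + (+ 2 - A * A) * x))) * t ≡
        + 4 - A * A + (- (+ 2 - A * A) - A * t) * (x - -1ℤ) + (- A + + 2 * t) * (y - - A)
      identity = solve-∀

    -- As m + 2 = p, this coefficient is -(α^p + α^-p), and Frobenius permutes the roots of Q. In
    -- the computation `u m` is recovered from `u p` and `u n` by running the recurrence backwards.
    wNonresidue-m : wNonresidue A m ≈ - A
    wNonresidue-m = ≈-by₂ (proj₁ lucas-values) (- A) (proj₂ lucas-values) (+ 2)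
      (trans (cong (λ x → A * x + (+ 2 - A * A) * u n) (backwards A (u n) (u m)))
        (identity A (u p) (u n)))
      where
      backwards : ∀ A y z → z ≡ A * y - (A * y - 1ℤ * z)
      backwards = solve-∀
      identity : ∀ A x y → A * (A * y - x) + (+ 2 - A * A) * y ≡
        - A + - A * (x - -1ℤ) + + 2 * (y - - A)
      identity = solve-∀

  module Residue (2≉0 : + 2 ≉ 0ℤ) (μ≉0 : μ ≉ 0ℤ)
    (x : ℤ) (x²≈ : x * x ≈ A * A - + 4) where

    -- By Fermat's theorem 2^(p-2) is the inverse of 2, so that `root` is the quadratic formula with
    -- `x` as the square root of the discriminant.
    half : ℤ
    half = (+ 2) ^ m

    root : ℤ
    root = half * (A + x)

    Q-root : Q root ≈ 0ℤ
    Q-root = *-cancelˡ p-prime (*-≉0 p-prime 2≉0 2≉0)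
      (≈-by₂ (fermat⁻ 2≉0) (((+ 2) * half * (A + x) + (A + x) - + 2 * A) * (A + x)) x²≈ 1ℤ
        (identity A x half))
      where
      identity : ∀ A x h →
        + 2 * + 2 * (h * (A + x) * (h * (A + x)) - A * (h * (A + x)) + 1ℤ) ≡
        + 2 * + 2 * 0ℤ + ((+ 2) * h * (A + x) + (A + x) - + 2 * A) * (A + x) * (+ 2 * h - 1ℤ)
          + 1ℤ * (x * x - (A * A - + 4))
      identity = solve-∀

    conjugate : ∀ t → Q (A - t) ≡ Q t
    conjugate t = identity A t
      where
      identity : ∀ A t → (A - t) * (A - t) - A * (A - t) + 1ℤ ≡ t * t - A * t + 1ℤ
      identity = solve-∀

    root≉0 : ∀ t → Q t ≈ 0ℤ → t ≉ 0ℤ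
    root≉0 t Q≈0 t≈0 = 1≉0 p-prime (≈-by₂ Q≈0 1ℤ t≈0 (A - t) (identity A t))
      where
      identity : ∀ A t → 1ℤ ≡ 0ℤ + 1ℤ * (t * t - A * t + 1ℤ - 0ℤ) + (A - t) * (t - 0ℤ)
      identity = solve-∀

    -- 2 t - A is the difference between t and the other root A - t, and its square is -μ.
    roots-distinct : ∀ t → Q t ≈ 0ℤ → + 2 * t - A ≉ 0ℤ
    roots-distinct t Q≈0 2t-A≈0 = μ≉0 (≈-by₂ (discriminant t Q≈0) 1ℤ 2t-A≈0 (- (+ 2 * t - A)) (identity A t))
      where
      identity : ∀ A t → + 4 - A * A ≡ 0ℤ +
        1ℤ * ((+ 2 * t - A) * (+ 2 * t - A) - (A * A - + 4)) + - (+ 2 * t - A) * (+ 2 * t - A - 0ℤ)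
      identity = solve-∀

    root-^ : ∀ t → Q t ≈ 0ℤ → ∀ k → t ^ suc k ≈ u (suc k) * t - u k
    root-^ t Q≈0 zero    = ≈-reflexive (identity t)
      where
      identity : ∀ t → t * 1ℤ ≡ 1ℤ * t - 0ℤ
      identity = solve-∀
    root-^ t Q≈0 (suc k) = ≈-by₂ (root-^ t Q≈0 k) t Q≈0 (u (suc k))
      (identity A t (t ^ suc k) (u (suc k)) (u k))
      where
      identity : ∀ A t w x y → t * w ≡ (A * x - 1ℤ * y) * t - x
        + t * (w - (x * t - y)) + x * (t * t - A * t + 1ℤ - 0ℤ)
      identity = solve-∀

    root-n : ∀ t → Q t ≈ 0ℤ → u n * t - u m ≈ 1ℤ
    root-n t Q≈0 = ≈-trans (≈-sym (root-^ t Q≈0 m)) (fermat⁻ (root≉0 t Q≈0))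

    -- Both roots satisfy the linear relation `root-n` with the same coefficients. Subtracting the
    -- two leaves `u n` times the difference of the roots.
    uₙ≈0 : u n ≈ 0ℤ
    uₙ≈0 = *-cancelˡ p-prime (roots-distinct root Q-root) (≈-by₂
      (root-n root Q-root) 1ℤ
      (root-n (A - root) (≈-trans (≈-reflexive (conjugate root)) Q-root)) -1ℤ
      (identity A root (u n) (u m)))
      where
      identity : ∀ A r y z → (+ 2 * r - A) * y ≡ (+ 2 * r - A) * 0ℤ
        + 1ℤ * (y * r - z - 1ℤ) + -1ℤ * (y * (A - r) - z - 1ℤ)
      identity = solve-∀

    uₘ≈-1 : u m ≈ -1ℤ
    uₘ≈-1 = ≈-by₂ (root-n root Q-root) -1ℤ uₙ≈0 root (identity root (u n) (u m))
      where
      identity : ∀ r y z → z ≡ -1ℤ + -1ℤ * (y * r - z - 1ℤ) + r * (y - 0ℤ)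
      identity = solve-∀

    uₚ≈1 : u p ≈ 1ℤ
    uₚ≈1 = ≈-by₂ uₙ≈0 A uₘ≈-1 -1ℤ (identity A (u n) (u m))
      where
      identity : ∀ A y z → A * y - 1ℤ * z ≡ 1ℤ + A * (y - 0ℤ) + -1ℤ * (z - -1ℤ)
      identity = solve-∀

    -- v k is α ^ (k + 2) + α ^ -(k + 2) for a root α of Q.
    v : ℕ → ℤ
    v k = (A * A - + 2) * u (suc k) - A * u k

    -- Modulo p the sequence `v` has period p - 1, so no boundary terms survive. Its polynomial is
    -- therefore supported on the roots of Q.
    Q-evaluate-v : ∀ {t} → t ≉ 0ℤ → Q t * evaluate v n t ≈ 0ℤ
    Q-evaluate-v {t} t≉0 = ≈-trans (Q-evaluate-homogeneous v recurrence t≉0)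
      (≈-by₂ uₚ≈1 (- (A * A - + 2) + A * t) uₙ≈0 (A - + 2 * t) (identity A (u p) (u n) t))
      where
      recurrence : ∀ k → v (suc (suc k)) ≡ A * v (suc k) - v k
      recurrence k = step A (u (suc k)) (u k)
        where
        step : ∀ A x y →
          (A * A - + 2) * (A * (A * x - 1ℤ * y) - 1ℤ * x) - A * (A * x - 1ℤ * y) ≡
          A * ((A * A - + 2) * (A * x - 1ℤ * y) - A * x) - ((A * A - + 2) * x - A * y)
        step = solve-∀
      identity : ∀ A x y t →
        ((A * A - + 2) * 1ℤ - A * 0ℤ - ((A * A - + 2) * x - A * y))
        + ((A * A - + 2) * (A * 1ℤ - 1ℤ * 0ℤ) - A * 1ℤ - A * ((A * A - + 2) * 1ℤ - A * 0ℤ)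
            - ((A * A - + 2) * (A * x - 1ℤ * y) - A * x - A * ((A * A - + 2) * x - A * y))) * t ≡
        0ℤ + (- (A * A - + 2) + A * t) * (x - 1ℤ) + (A - + 2 * t) * (y - 0ℤ)
      identity = solve-∀

    wResidue-n : wResidue A n ≈ + 2
    wResidue-n = ≈-by₃ uₙ≈0 (- A) uₚ≈1 (+ n * μ + + 6 - A * A) p≈0 μ (identity A (+ n) (u p) (u n))
      where
      identity : ∀ A N x y → - A * y + (N * (+ 4 - A * A) + + 6 - A * A) * x ≡ + 2
        + - A * (y - 0ℤ) + (N * (+ 4 - A * A) + + 6 - A * A) * (x - 1ℤ)
        + (+ 4 - A * A) * (1ℤ + N - 0ℤ)
      identity = solve-∀

    wResidue-p : wResidue A p ≈ (+ 5 - A * A) * A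
    wResidue-p = ≈-by₃ uₚ≈1 (- A + A * (+ p * μ + + 6 - A * A)) uₙ≈0 (- (+ p * μ + + 6 - A * A))
      p≈0 (A * μ) (identity A (+ p) (u p) (u n))
      where
      identity : ∀ A P x y → - A * x + (P * (+ 4 - A * A) + + 6 - A * A) * (A * x - 1ℤ * y) ≡
        (+ 5 - A * A) * A + (- A + A * (P * (+ 4 - A * A) + + 6 - A * A)) * (x - 1ℤ)
        + - (P * (+ 4 - A * A) + + 6 - A * A) * (y - 0ℤ) + A * (+ 4 - A * A) * (P - 0ℤ)
      identity = solve-∀

    -- Under the recurrence the part (k + 2) μ u (k+1) of the coefficients leaves the forcing term μ
    -- (u (k+3) - u (k+1)) = μ `v k`. As t² times the polynomial of `v` is -1 at the roots of Q and
    -- 0 at the other nonzero residues, the right side is μ off the roots and 0 at them.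
    Q-evaluate-w : ∀ {t} → t ≉ 0ℤ →
      Q t * evaluate (wResidue A) n t ≈ μ + t * t * (μ * evaluate v n t)
    Q-evaluate-w {t} t≉0 = ≈-trans (Q-evaluate (wResidue A) (λ k → μ * v k) recurrence t≉0)
      (≈-trans (≈-reflexive (cong (λ e → r + t * t * e) (evaluate-scale μ v n t)))
        (≈-by₂ wResidue-n (-1ℤ + A * t) wResidue-p (- t)
          (identity A t (wResidue A n) (wResidue A p) (evaluate v n t))))
      where
      r = (wResidue A 0 - wResidue A n) +
        (wResidue A 1 - A * wResidue A 0 - (wResidue A p - A * wResidue A n)) * t
      recurrence : ∀ k → wResidue A (suc (suc k)) ≡ A * wResidue A (suc k) - wResidue A k + μ * v k
      recurrence k = step A (+ k) (u (suc k)) (u k)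
        where
        step : ∀ A K x y →
          - A * (A * x - 1ℤ * y) +
            ((+ 2 + K) * (+ 4 - A * A) + + 6 - A * A) * (A * (A * x - 1ℤ * y) - 1ℤ * x) ≡
          A * (- A * x + ((1ℤ + K) * (+ 4 - A * A) + + 6 - A * A) * (A * x - 1ℤ * y))
            - (- A * y + (K * (+ 4 - A * A) + + 6 - A * A) * x)
            + (+ 4 - A * A) * ((A * A - + 2) * x - A * y)
        step = solve-∀
      identity : ∀ A t a b e →
        (- A * 0ℤ + (0ℤ * (+ 4 - A * A) + + 6 - A * A) * 1ℤ - a) +
        (- A * 1ℤ + (1ℤ * (+ 4 - A * A) + + 6 - A * A) * (A * 1ℤ - 1ℤ * 0ℤ)
          - A * (- A * 0ℤ + (0ℤ * (+ 4 - A * A) + + 6 - A * A) * 1ℤ) - (b - A * a)) * t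
        + t * t * ((+ 4 - A * A) * e) ≡
        + 4 - A * A + t * t * ((+ 4 - A * A) * e)
          + (-1ℤ + A * t) * (a - + 2) + - t * (b - (+ 5 - A * A) * A)
      identity = solve-∀

    -- The closed forms are written in t and t ^ l alone: the other root is A - t,
    -- and Q t ≈ 0 makes it the inverse of t.
    module AtRoot (t : ℤ) (Q≈0 : Q t ≈ 0ℤ) where

      Δ s : ℤ
      Δ = + 2 * t - A
      s = A - t

      -- Binet's formula Δ u l = t^l - s^l, multiplied by t^l so that the power of `s` disappears.
      -- Two consecutive indices are carried along because the recurrence has order two.
      binet : ∀ l →
        (Δ * t ^ l * u l ≈ t ^ l * t ^ l - 1ℤ) × (Δ * t ^ l * u (suc l) ≈ t * (t ^ l * t ^ l) - s)
      binet zero = ≈-reflexive (identity₀ A t) , ≈-reflexive (identity₁ A t)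
        where
        identity₀ : ∀ A t → (+ 2 * t - A) * 1ℤ * 0ℤ ≡ 1ℤ * 1ℤ - 1ℤ
        identity₀ = solve-∀
        identity₁ : ∀ A t → (+ 2 * t - A) * 1ℤ * 1ℤ ≡ t * (1ℤ * 1ℤ) - (A - t)
        identity₁ = solve-∀
      binet (suc l) with binet l
      ... | binetₗ , binetₗ₊₁ =
          ≈-by₂ binetₗ₊₁ t Q≈0 1ℤ (identity₀ A t (t ^ l) (u (suc l)))
        , ≈-by₃ binetₗ₊₁ (A * t) binetₗ (- t) Q≈0 (A - t * (t ^ l * t ^ l)) (identity₁ A t (t ^ l) (u (suc l)) (u l))
        where
        identity₀ : ∀ A t T x → (+ 2 * t - A) * (t * T) * x ≡ t * T * (t * T) - 1ℤ
          + t * ((+ 2 * t - A) * T * x - (t * (T * T) - (A - t))) + 1ℤ * (t * t - A * t + 1ℤ - 0ℤ)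
        identity₀ = solve-∀
        identity₁ : ∀ A t T x y → (+ 2 * t - A) * (t * T) * (A * x - 1ℤ * y) ≡
          t * (t * T * (t * T)) - (A - t)
          + A * t * ((+ 2 * t - A) * T * x - (t * (T * T) - (A - t)))
          + - t * ((+ 2 * t - A) * T * y - (T * T - 1ℤ))
          + (A - t * (T * T)) * (t * t - A * t + 1ℤ - 0ℤ)
        identity₁ = solve-∀

      -- Here `L` stands for l and `R` for t^(2l). By `binet` the summands are powers of t² and
      -- constants, with weights linear in the index. The division by t² - 1 = t Δ that summing the
      -- powers requires is exact because μ = -Δ², and the factor 2 in `evaluate-closed` avoids
      -- halving L (L - 1).
      closed : ℤ → ℤ → ℤ
      closed L R = + 2 * (+ 2 * s - L * Δ) * R - + 4 * s + + 2 * L * A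
        - s * (μ * (L * (L - 1ℤ)) + + 2 * (μ + + 2) * L)

      evaluate-closed : ∀ l → + 2 * Δ * evaluate (wResidue A) l t ≈ closed (+ l) (t ^ l * t ^ l)
      evaluate-closed zero = ≈-reflexive (identity A t)
        where
        identity : ∀ A t → + 2 * (+ 2 * t - A) * 0ℤ ≡
          + 2 * (+ 2 * (A - t) - 0ℤ * (+ 2 * t - A)) * (1ℤ * 1ℤ) - + 4 * (A - t) + + 2 * 0ℤ * A
          - (A - t) * ((+ 4 - A * A) * (0ℤ * (0ℤ - 1ℤ)) + + 2 * (+ 4 - A * A + + 2) * 0ℤ)
        identity = solve-∀
      evaluate-closed (suc l) = begin
        + 2 * Δ * evaluate (wResidue A) (suc l) t
          ≡⟨ cong (λ e → + 2 * Δ * e) (evaluate-last (wResidue A) l t) ⟩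
        + 2 * Δ * (evaluate (wResidue A) l t + wResidue A l * t ^ l)
          ≡⟨ ℤₚ.*-distribˡ-+ (+ 2 * Δ) (evaluate (wResidue A) l t) (wResidue A l * t ^ l) ⟩
        + 2 * Δ * evaluate (wResidue A) l t + + 2 * Δ * (wResidue A l * t ^ l)
          ≈⟨ +-cong (evaluate-closed l) ≈-refl ⟩
        closed (+ l) (t ^ l * t ^ l) + + 2 * Δ * (wResidue A l * t ^ l)
          ≈⟨ ≈-by₃ (proj₁ (binet l)) (- (+ 2 * A)) (proj₂ (binet l)) (+ 2 * (+ l * μ + + 6 - A * A))
               Q≈0 (+ 2 * (t ^ l * t ^ l) * (+ l * (+ 2 * t + A) + + 4 * t + A))
               (identity A t (+ l) (t ^ l) (u (suc l)) (u l)) ⟩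
        closed (+ suc l) (t ^ suc l * t ^ suc l) ∎
        where
        open ≈-Reasoning
        identity : ∀ A t L T x y →
          + 2 * (+ 2 * (A - t) - L * (+ 2 * t - A)) * (T * T) - + 4 * (A - t) + + 2 * L * A
          - (A - t) * ((+ 4 - A * A) * (L * (L - 1ℤ)) + + 2 * (+ 4 - A * A + + 2) * L)
          + + 2 * (+ 2 * t - A) * ((- A * y + (L * (+ 4 - A * A) + + 6 - A * A) * x) * T) ≡
          + 2 * (+ 2 * (A - t) - (1ℤ + L) * (+ 2 * t - A)) * (t * T * (t * T)) - + 4 * (A - t) + + 2 * (1ℤ + L) * A
          - (A - t) * ((+ 4 - A * A) * ((1ℤ + L) * ((1ℤ + L) - 1ℤ)) + + 2 * (+ 4 - A * A + + 2) * (1ℤ + L))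
          + - (+ 2 * A) * ((+ 2 * t - A) * T * y - (T * T - 1ℤ))
          + + 2 * (L * (+ 4 - A * A) + + 6 - A * A) * ((+ 2 * t - A) * T * x - (t * (T * T) - (A - t)))
          + + 2 * (T * T) * (L * (+ 2 * t + A) + + 4 * t + A) * (t * t - A * t + 1ℤ - 0ℤ)
        identity = solve-∀

      evaluate-w≈0 : evaluate (wResidue A) n t ≈ 0ℤ
      evaluate-w≈0 = *-cancelˡ p-prime (*-≉0 p-prime 2≉0 (roots-distinct t Q≈0)) (≈-trans
        (evaluate-closed n)
        -- With t^n ≡ 1 the closed form collapses to -(s μ n (n + 1)), and n + 1 = p.
        (≈-by₂ (fermat⁻ (root≉0 t Q≈0)) (+ 2 * (+ 2 * s - + n * Δ) * (t ^ n + 1ℤ)) p≈0 (- (s * μ * + n))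
          (identity A t (+ n) (t ^ n))))
        where
        identity : ∀ A t L T →
          + 2 * (+ 2 * (A - t) - L * (+ 2 * t - A)) * (T * T) - + 4 * (A - t) + + 2 * L * A
          - (A - t) * ((+ 4 - A * A) * (L * (L - 1ℤ)) + + 2 * (+ 4 - A * A + + 2) * L) ≡
          + 2 * (+ 2 * t - A) * 0ℤ
          + + 2 * (+ 2 * (A - t) - L * (+ 2 * t - A)) * (T + 1ℤ) * (T - 1ℤ)
          + - ((A - t) * (+ 4 - A * A) * L) * (1ℤ + L - 0ℤ)
        identity = solve-∀

    -- At a root of Q the left side is μ times 0^m, which is 0 only for a positive exponent; this is
    -- what `m ≢ 0` secures. Off the roots the forcing term vanishes and Q can be inverted.
    interpolates : m ≢ 0 → ∀ {t} → t ≉ 0ℤ → μ * Q t ^ m ≈ evaluate (wResidue A) n t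
    interpolates m≢0 {t} t≉0 = split (+ p ∣? Q t)
      where
      power-≈0 : ∀ l → l ≢ 0 → Q t ≈ 0ℤ → μ * Q t ^ l ≈ 0ℤ
      power-≈0 zero    l≢0 Q≈0 = contradiction refl l≢0
      power-≈0 (suc l) _   Q≈0 = ≈-trans (*-congˡ μ (*-congʳ (Q t ^ l) Q≈0)) (≈-reflexive (ℤₚ.*-zeroʳ μ))
      identity : ∀ μ t e → μ + t * t * (μ * e) ≡ μ + t * t * μ * (e - 0ℤ)
      identity = solve-∀
      off-roots : Q t ≉ 0ℤ → Q t * evaluate (wResidue A) n t ≈ μ
      off-roots Q≉0 = [ (λ Q≈0 → contradiction Q≈0 Q≉0)
        , (λ v≈0 → ≈-trans (Q-evaluate-w t≉0)
            (≈-by₁ v≈0 (t * t * μ) (identity μ t (evaluate v n t))))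
        ]′ (euclid p-prime (Q t) (evaluate v n t) (Q-evaluate-v t≉0))
      split : Dec (+ p ∣ Q t) → μ * Q t ^ m ≈ evaluate (wResidue A) n t
      split (yes p∣Q) = ≈-trans (power-≈0 m m≢0 (∣⇒≈0 p∣Q)) (≈-sym (AtRoot.evaluate-w≈0 t (∣⇒≈0 p∣Q)))
      split (no p∤Q)  = invert-Q t Q≉0 (off-roots Q≉0)
        where
        Q≉0 : Q t ≉ 0ℤ
        Q≉0 Q≈0 = p∤Q (≈0⇒∣ Q≈0)

    wResidue-m : wResidue A m ≈ A
    wResidue-m = ≈-by₂ uₘ≈-1 (- A) uₙ≈0 (+ m * μ + + 6 - A * A) (identity A (+ m) (u n) (u m))
      where
      identity : ∀ A M y z → - A * z + (M * (+ 4 - A * A) + + 6 - A * A) * y ≡ A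
        + - A * (z - -1ℤ) + (M * (+ 4 - A * A) + + 6 - A * A) * (y - 0ℤ)
      identity = solve-∀

    -- For p = 3 and A ≡ 0 the value u 3 = A² - 1 would be -1, against `uₚ≈1`. So whenever A ≡ 0 in
    -- the residue case, index 1 is at most p - 3.
    A≈0⇒m≢1 : A ≈ 0ℤ → m ≢ 1
    A≈0⇒m≢1 A≈0 m≡1 = 2≉0 (≈-by₂ (subst (λ l → u (suc (suc l)) ≈ 1ℤ) m≡1 uₚ≈1) -1ℤ A≈0 A (identity A))
      where
      identity : ∀ A → + 2 ≡ 0ℤ + -1ℤ * (A * (A * 1ℤ - 1ℤ * 0ℤ) - 1ℤ * 1ℤ - 1ℤ) + A * (A - 0ℤ)
      identity = solve-∀

-- The Legendre symbol, the index range and the two criteria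

wResidue-1 : ∀ A → wResidue A 1 ≡ (+ 9 - + 2 * A * A) * A
wResidue-1 = identity
  where
  identity : ∀ A → - A * 1ℤ + (1ℤ * (+ 4 - A * A) + + 6 - A * A) * (A * 1ℤ - 1ℤ * 0ℤ) ≡
    (+ 9 - + 2 * A * A) * A
  identity = solve-∀

wNonresidue-1 : ∀ A → wNonresidue A 1 ≡ (+ 3 - A * A) * A
wNonresidue-1 = identity
  where
  identity : ∀ A → A * 1ℤ + (+ 2 - A * A) * (A * 1ℤ - 1ℤ * 0ℤ) ≡ (+ 3 - A * A) * A
  identity = solve-∀

legendre≡1⇒square : ∀ a p → legendre a p ≡ 1ℤ → ∃[ x ] x * x ≡ a [mod p ]
legendre≡1⇒square a p eq with + p ∣? a
legendre≡1⇒square a p () | yes _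
legendre≡1⇒square a p eq | no _ with any? {n = p} (λ x → + p ∣? (+ toℕ x) ^ 2 - a)
legendre≡1⇒square a p eq | no _ | yes (x , p∣x²-a) =
  + toℕ x , subst (λ y → + p ∣ + toℕ x * y - a) (ℤₚ.*-identityʳ (+ toℕ x)) p∣x²-a
legendre≡1⇒square a p () | no _ | no _

-- The search behind `legendre` has tried only 0 to p - 1, so a square root `x` is first replaced by
-- its remainder modulo p.
legendre≡-1⇒nonsquare : ∀ a p ⦃ _ : ℕ.NonZero p ⦄ → legendre a p ≡ -1ℤ → ∀ x → ¬ (x * x ≡ a [mod p ])
legendre≡-1⇒nonsquare a p eq x x²≡a with + p ∣? a
legendre≡-1⇒nonsquare a p () x x²≡a | yes _
legendre≡-1⇒nonsquare a p eq x x²≡a | no _ with any? {n = p} (λ x → + p ∣? (+ toℕ x) ^ 2 - a)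
legendre≡-1⇒nonsquare a p () x x²≡a | no _ | yes _
legendre≡-1⇒nonsquare a p eq x x²≡a | no _ | no ¬square =
  ¬square (fromℕ< (n%ℕd<d x p) , subst (λ r → + p ∣ (+ r) ^ 2 - a) (sym (toℕ-fromℕ< (n%ℕd<d x p)))
    (subst (+ p ∣_) (identity (+ (x %ℕ p)) (x /ℕ p) (+ p) a)
      (∣m∣n⇒∣m+n (subst (λ y → + p ∣ y * y - a) (a≡a%ℕn+[a/ℕn]*n x p) x²≡a)
        (∣n⇒∣m*n (- (+ 2 * + (x %ℕ p) * (x /ℕ p) + (x /ℕ p) * (x /ℕ p) * + p)) (∣ᵤ⇒∣ ℕ∣.∣-refl)))))
  where
  identity : ∀ r q p a → (r + q * p) * (r + q * p) - a + - (+ 2 * r * q + q * q * p) * p ≡ r * (r * 1ℤ) - a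
  identity = solve-∀

-- A zero at the last index p - 2 forces A ≈ 0, and then index 1 is a zero too.
module Range {q : ℕ} (p-prime : Prime (suc (suc (suc q)))) (A : ℤ) where
  open Modular (suc (suc (suc q)))

  restrict : (w : ℕ → ℤ) → (w (suc q) ≈ 0ℤ → A ≈ 0ℤ) → (A ≈ 0ℤ → 1 ≤ q × w 1 ≈ 0ℤ) →
    ∃[ k ] w (toℕ {suc (suc q)} k) ≈ 0ℤ → ∃[ k ] (k ≤ q × w k ≈ 0ℤ)
  restrict w last⇒A A⇒w₁ (k , wₖ≈0) with ℕₚ.m≤n⇒m<n∨m≡n (ℕ.s≤s⁻¹ (toℕ<n k))
  ... | inj₁ k<1+q = toℕ k , ℕ.s≤s⁻¹ k<1+q , wₖ≈0
  ... | inj₂ k≡1+q = 1 , A⇒w₁ (last⇒A (subst (λ l → w l ≈ 0ℤ) k≡1+q wₖ≈0))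

  extend : (w : ℕ → ℤ) → ∃[ k ] (k ≤ q × w k ≈ 0ℤ) → ∃[ k ] w (toℕ {suc (suc q)} k) ≈ 0ℤ
  extend w (k , k≤q , wₖ≈0) = fromℕ< k<n , subst (λ l → w l ≈ 0ℤ) (sym (toℕ-fromℕ< k<n)) wₖ≈0
    where
    k<n : k < suc (suc q)
    k<n = ℕ.s≤s (ℕₚ.m≤n⇒m≤1+n k≤q)

module OddPrime {q : ℕ} (p-prime : Prime (suc (suc (suc q)))) (c : ℤ)
  (c≢2 : ¬ (c ≡ + 2 [mod suc (suc (suc q)) ])) (c≢-2 : ¬ (c ≡ - (+ 2) [mod suc (suc (suc q)) ])) where
  open Modular (suc (suc (suc q)))
  open PrimeModulus p-prime using (n; det-D≈0⇒; det-D≈0⇐) renaming (p to p′)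
  open Range p-prime (- c)

  private
    A μ : ℤ
    A = - c
    μ = + 4 - A * A

    2≉0 : + 2 ≉ 0ℤ
    2≉0 = small≉0 p-prime (ℕ.s≤s (ℕ.s≤s (ℕ.s≤s ℕ.z≤n)))

    μ≉0 : μ ≉ 0ℤ
    μ≉0 μ≈0 = [ (λ c-2≈0 → c≢2 (≈0⇒∣ c-2≈0)) , (λ c+2≈0 → c≢-2 (≈0⇒∣ c+2≈0)) ]′
      (euclid p-prime (c - + 2) (c - - (+ 2)) (≈-by₁ μ≈0 -1ℤ (identity c)))
      where
      identity : ∀ c → (c - + 2) * (c - - (+ 2)) ≡ 0ℤ + -1ℤ * (+ 4 - - c * - c - 0ℤ)
      identity = solve-∀

    discriminant-c : c ^ 2 - + 4 ≡ A * A - + 4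
    discriminant-c = identity c
      where
      identity : ∀ c → c * (c * 1ℤ) - + 4 ≡ - c * - c - + 4
      identity = solve-∀

    charPoly-c : ∀ t → charPoly A t ≡ t * t + c * t + 1ℤ
    charPoly-c t = identity c t
      where
      identity : ∀ c t → t * t - - c * t + 1ℤ ≡ t * t + c * t + 1ℤ
      identity = solve-∀

    -- The part common to both cases: `w` is the coefficient sequence written in A, and `w′` is the
    -- same sequence written in c as in the theorem. The last two hypotheses reconcile the indices
    -- up to p - 2 with the range up to p - 3.
    criterion : (w w′ : ℕ → ℤ) → (∀ k → w′ k ≡ w k) →
      (∀ {t} → t ≉ 0ℤ → μ * charPoly A t ^ suc q ≈ evaluate w (suc (suc q)) t) →
      (w (suc q) ≈ 0ℤ → A ≈ 0ℤ) → (A ≈ 0ℤ → 1 ≤ q × w 1 ≈ 0ℤ) →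
      (+ suc (suc (suc q)) ∣ det (suc (suc (suc q)) ∸ 1) (D (suc (suc (suc q))) c)) ⇔
      (∃[ k ] (k ≤ q × w′ k ≡ + 0 [mod suc (suc (suc q)) ]))
    criterion w w′ w′≡w interpolates last⇒A A⇒w₁ = mk⇔
      (λ p∣D → forwards (restrict w last⇒A A⇒w₁
        (det-D≈0⇒ c μ μ≉0 w interpolates′ (≈-trans (≈-reflexive (sym det-D≡)) (∣⇒≈0 p∣D)))))
      (λ zero′ → ≈0⇒∣ (≈-trans (≈-reflexive det-D≡)
        (det-D≈0⇐ c μ μ≉0 w interpolates′ (extend w (backwards zero′)))))
      where
      forwards : ∃[ k ] (k ≤ q × w k ≈ 0ℤ) → ∃[ k ] (k ≤ q × w′ k ≡ + 0 [mod suc (suc (suc q)) ])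
      forwards (k , k≤q , wₖ≈0) =
        k , k≤q , congruent-mod {w′ k} {0ℤ} (≈-trans (≈-reflexive (w′≡w k)) wₖ≈0)
      backwards : ∃[ k ] (k ≤ q × w′ k ≡ + 0 [mod suc (suc (suc q)) ]) → ∃[ k ] (k ≤ q × w k ≈ 0ℤ)
      backwards (k , k≤q , w′ₖ≡0) =
        k , k≤q , ≈-trans (≈-reflexive (sym (w′≡w k))) (congruence {w′ k} {0ℤ} w′ₖ≡0)
      det-D≡ : det (suc (suc (suc q)) ∸ 1) (D (suc (suc (suc q))) c) ≡ det n (D p′ c)
      det-D≡ = det-transport {suc (suc (suc q)) ∸ 1} {n} refl
        (D (suc (suc (suc q))) c) (D p′ c) (λ _ _ → refl)
      interpolates′ : ∀ {t} → t ≉ 0ℤ → μ * (t * t + c * t + 1ℤ) ^ suc q ≈ evaluate w (suc (suc q)) t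
      interpolates′ {t} t≉0 =
        ≈-trans (≈-reflexive (cong (λ x → μ * x ^ suc q) (sym (charPoly-c t)))) (interpolates t≉0)

  residue-criterion : legendre (c ^ 2 - + 4) (suc (suc (suc q))) ≡ 1ℤ →
    (+ suc (suc (suc q)) ∣ det (suc (suc (suc q)) ∸ 1) (D (suc (suc (suc q))) c)) ⇔
    (∃[ k ] (k ≤ q ×
      c * lucas (- c) 1ℤ k + (+ k * (+ 4 - c ^ 2) + + 6 - c ^ 2) * lucas (- c) 1ℤ (suc k)
        ≡ + 0 [mod suc (suc (suc q)) ]))
  residue-criterion legendre≡1 = criterion (wResidue A)
    (λ k → c * lucas (- c) 1ℤ k + (+ k * (+ 4 - c ^ 2) + + 6 - c ^ 2) * lucas (- c) 1ℤ (suc k))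
    (λ k → identity c (+ k) (lucas A 1ℤ (suc k)) (lucas A 1ℤ k))
    (interpolates λ ())
    (λ last≈0 → ≈-trans (≈-sym wResidue-m) last≈0)
    (λ A≈0 → ℕₚ.n≢0⇒n>0 (λ q≡0 → A≈0⇒m≢1 A≈0 (cong suc q≡0))
           , ≈-trans (≈-reflexive (wResidue-1 A)) (≈-trans (*-congˡ (+ 9 - + 2 * A * A) A≈0)
               (≈-reflexive (ℤₚ.*-zeroʳ (+ 9 - + 2 * A * A)))))
    where
    square = legendre≡1⇒square (c ^ 2 - + 4) (suc (suc (suc q))) legendre≡1
    open Interpolation p-prime A using (module Residue)
    open Residue 2≉0 μ≉0 (proj₁ square)
      (≈-trans (congruence {proj₁ square * proj₁ square} {c ^ 2 - + 4} (proj₂ square)) (≈-reflexive discriminant-c))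
    identity : ∀ c K x y →
      c * y + (K * (+ 4 - c * (c * 1ℤ)) + + 6 - c * (c * 1ℤ)) * x ≡
      - - c * y + (K * (+ 4 - - c * - c) + + 6 - - c * - c) * x
    identity = solve-∀

  nonresidue-criterion : legendre (c ^ 2 - + 4) (suc (suc (suc q))) ≡ -1ℤ → suc (suc (suc q)) ≢ 3 →
    (+ suc (suc (suc q)) ∣ det (suc (suc (suc q)) ∸ 1) (D (suc (suc (suc q))) c)) ⇔
    (∃[ k ] (k ≤ q ×
      (- c) * lucas (- c) 1ℤ k + (+ 2 - c ^ 2) * lucas (- c) 1ℤ (suc k)
        ≡ + 0 [mod suc (suc (suc q)) ]))
  nonresidue-criterion legendre≡-1 p≢3 = criterion (wNonresidue A)
    (λ k → (- c) * lucas (- c) 1ℤ k + (+ 2 - c ^ 2) * lucas (- c) 1ℤ (suc k))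
    (λ k → identity c (lucas A 1ℤ (suc k)) (lucas A 1ℤ k))
    interpolates
    (λ last≈0 → ≈-by₂ wNonresidue-m 1ℤ last≈0 -1ℤ (cancel A (wNonresidue A (suc q))))
    -- With A ≡ 0 the zero at index p - 2 is exchanged for the one at index 1, which is at most p -
    -- 3 = `q` because p is not 3.
    (λ A≈0 → ℕₚ.n≢0⇒n>0 (λ q≡0 → p≢3 (cong (λ l → suc (suc (suc l))) q≡0))
           , ≈-trans (≈-reflexive (wNonresidue-1 A)) (≈-trans (*-congˡ (+ 3 - A * A) A≈0)
               (≈-reflexive (ℤₚ.*-zeroʳ (+ 3 - A * A)))))
    where
    open Interpolation p-prime A using (module Nonresidue)
    open Nonresidue 2≉0 μ≉0 (λ x x²≈ → legendre≡-1⇒nonsquare (c ^ 2 - + 4) (suc (suc (suc q))) legendre≡-1 x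
      (congruent-mod {x * x} {c ^ 2 - + 4} (≈-trans x²≈ (≈-reflexive (sym discriminant-c)))))
    identity : ∀ c x y → - c * y + (+ 2 - c * (c * 1ℤ)) * x ≡ - c * y + (+ 2 - - c * - c) * x
    identity = solve-∀
    cancel : ∀ A w → A ≡ 0ℤ + 1ℤ * (w - - A) + -1ℤ * (w - 0ℤ)
    cancel = solve-∀

theorem1p3 : (p : ℕ) → Prime p → ¬ (2 ∣ℕ p) → (c : ℤ) →
    ¬ (c ≡ + 2 [mod p ]) → ¬ (c ≡ - (+ 2) [mod p ]) →
    (legendre (c ^ 2 - + 4) p ≡ 1ℤ →
    (+ p ∣ det (p ∸ 1) (D p c)) ⇔
    (∃[ k ] (k ≤ p ∸ 3 ×
    c * lucas (- c) 1ℤ k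
    + (+ k * (+ 4 - c ^ 2) + + 6 - c ^ 2) * lucas (- c) 1ℤ (suc k)
    ≡ + 0 [mod p ])))
    ×
    (legendre (c ^ 2 - + 4) p ≡ -1ℤ → p ≢ 3 →
    (+ p ∣ det (p ∸ 1) (D p c)) ⇔
    (∃[ k ] (k ≤ p ∸ 3 ×
    (- c) * lucas (- c) 1ℤ k
    + (+ 2 - c ^ 2) * lucas (- c) 1ℤ (suc k)
    ≡ + 0 [mod p ])))
theorem1p3 0 p-prime = contradiction p-prime ¬prime[0]
theorem1p3 1 p-prime = contradiction p-prime ¬prime[1]
theorem1p3 2 p-prime 2∤2 = contradiction ℕ∣.∣-refl 2∤2
theorem1p3 (suc (suc (suc q))) p-prime _ c c≢2 c≢-2 = residue-criterion , nonresidue-criterion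
  where open OddPrime p-prime c c≢2 c≢-2
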